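{- Let $w\in S_n$ be a permutation avoiding the pattern $1423$. Then the reduction map \[\Phi\colon \mathrm{MRPD}(w)\longrightarrow\bigsqcup_{v\le w}\mathrm{CMRPD}(v),\] where $v$ ranges over all subwords of $w$, is a bijection.
   Context: Words. A word is a finite sequence of distinct positive integers; a subword of $w=w(1)\cdots w(n)$ is $w(i_1)\cdots w(i_m)$ with $i_1<\cdots<i_m$ (including the empty word). $w$ avoids $1423$ if there are no $i_1<i_2<i_3<i_4$ with $w(i_1)<w(i_3)<w(i_4)<w(i_2)$. Pipe dreams. Let $v$ be a word of length $m$ with entries $a_1<\cdots<a_m$. The staircase of rank $m$ consists of cells $(i,k)$, $i,k\ge1$, $i+k\le m+1$ (row $i$ from the top, column $k$ from the left). Fill each cell with a crossing tile (a vertical segment top-to-bottom crossing a horizontal segment right-to-left) or a bumping tile (one arc joining top edge to left edge, another joining right edge to bottom edge), with cells satisfying $i+k=m+1$ bumping. The pipe labelled $a_k$ enters at the top of column $k$, follows the segments moving down and left, and exits through the left boundary. This is a reduced pipe dream of $v$ if any two pipes meet in at most one crossing tile and the labels read on the left boundary from top to bottom form $v$. A marked reduced pipe dream of $v$ is a reduced pipe dream of $v$ with a set of marked bumping tiles, where a bumping tile in row $i$ may be marked only if its two pipes cross at a crossing tile in a row strictly above row $i$. $\mathrm{MRPD}(v)$ is the set of these. Removable pipes and cores. Pipe $j$ of $P\in\mathrm{MRPD}(v)$ is removable if: (i) the column where pipe $j$ enters consists, from top to bottom, of crossing tiles all traversed by pipe $j$ followed by unmarked bumping tiles only; (ii)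 for each crossing tile traversed by pipe $j$, the tile directly above it (if any) is not an unmarked bumping tile; (iii) pipe $j$ traverses no marked bumping tile. $P$ is a core if no pipe is removable; $\mathrm{CMRPD}(v)$ is the set of core elements of $\mathrm{MRPD}(v)$ (the empty pipe dream is the core of the empty word). The map $\Phi_j$. For pipe $j$ removable in $P$ of rank $m$, entering column $c$: in each column $k<c$, pipe $j$ passes either through a single crossing tile $(r_k,k)$ horizontally or through two vertically adjacent unmarked bumping tiles $(r_k,k),(r_k+1,k)$. $\Phi_j(P)$ (rank $m-1$) is defined by: for $k>c$, column $k-1$ of $\Phi_j(P)$ is column $k$ of $P$; column $c$ is deleted; for $k<c$, cells $(r,k)$ with $r<r_k$ are unchanged, and in the crossing case cell $(r,k)$, $r\ge r_k$, receives the tile (with mark) of $(r+1,k)$ of $P$, while in the bumping case cell $(r_k,k)$ receives an unmarked bumping tile and cell $(r,k)$, $r>r_k$, receives the tile (with mark) of $(r+1,k)$. Pipes keep their labels; $\Phi_j(P)$ is a marked reduced pipe dream of $v$ with $j$ deleted. The reduction map. For $P\in\mathrm{MRPD}(w)$ with removable pipes $j_1,\dots,j_k$, set $\Phi(P)=\Phi_{j_k}(\cdots\Phi_{j_1}(P)\cdots)$. This is independent of the order (the $\Phi_j$ commute, a removable pipe stays removable and a non-removable pipe stays non-removable after applying another $\Phi_j$), and $\Phi(P)$ is a core marked reduced pipe dream of the subword of $w$ obtained by deleting $j_1,\dots,j_k$. -}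

module Defs where

open import Data.Nat using (ℕ; zero; suc; _+_; _∸_; _<_; _≡ᵇ_; _<ᵇ_; _≤ᵇ_)
open import Data.Bool using (Bool; true; false; _∧_; _∨_; not; if_then_else_)
open import Data.Maybe using (Maybe; just; nothing)
open import Data.List using (List; []; _∷_; _++_; map; length; upTo; downFrom)
open import Data.List.Membership.Propositional using (_∈_)
open import Data.List.Relation.Unary.All using (All)
open import Data.Product using (Σ; _×_; _,_; proj₁; proj₂; ∃)
open import Data.Sum using (_⊎_)
open import Data.Fin as Fin using (Fin)
open import Relation.Binary.PropositionalEquality using (_≡_; _≢_)
open import Relation.Nullary using (¬_)

Avoids1423 : List ℕ → Set
Avoids1423 w = (i₁ i₂ i₃ i₄ : Fin (length w)) →
  i₁ Fin.< i₂ → i₂ Fin.< i₃ → i₃ Fin.< i₄ →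
  ¬ (Data.List.lookup w i₁ < Data.List.lookup w i₃ ×
     Data.List.lookup w i₃ < Data.List.lookup w i₄ ×
     Data.List.lookup w i₄ < Data.List.lookup w i₂)

filterᵇ : {A : Set} → (A → Bool) → List A → List A
filterᵇ p [] = []
filterᵇ p (x ∷ xs) = if p x then x ∷ filterᵇ p xs else filterᵇ p xs

from1 : ℕ → List ℕ
from1 n = map suc (upTo n)

-- cross = crossing tile, bump = unmarked bumping tile, mbump = marked bumping tile
data Tile : Set where
  cross bump mbump : Tile

-- A (marked) pipe dream of rank m: list of rows (top to bottom),
-- each row a list of tiles (left to right); row i (1-indexed) has m+1-i cells.
PipeDream : Set
PipeDream = List (List Tile)

-- Information about a cell of a traced pipe dream: position (1-indexed),
-- tile, label of the pipe entering from the top, label of the pipe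
-- entering from the right (nothing = no pipe).
record Cell : Set where
  constructor mkCell
  field
    row col : ℕ
    tile : Tile
    top right : Maybe ℕ
open Cell public

-- (left exit, bottom exit) of a tile given (top entry, right entry)
cellOut : Tile → Maybe ℕ → Maybe ℕ → Maybe ℕ × Maybe ℕ
cellOut cross t h = h , t
cellOut bump  t h = t , h
cellOut mbump t h = t , h

-- trace one row (row index i, starting column k), given the labels entering
-- each column from above; returns (label exiting left, labels exiting bottom, cells)
traceRow : ℕ → ℕ → List Tile → List (Maybe ℕ) → Maybe ℕ × List (Maybe ℕ) × List Cell
traceRow i k [] ts = nothing , [] , []
traceRow i k (x ∷ xs) [] = nothing , [] , []
traceRow i k (x ∷ xs) (t ∷ ts) =
  let r = traceRow i (suc k) xs ts
      h = proj₁ r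
      o = cellOut x t h
  in proj₁ o , (proj₂ o ∷ proj₁ (proj₂ r)) , (mkCell i k x t h ∷ proj₂ (proj₂ r))

-- trace all rows from row i; returns (labels on the left boundary, cells)
traceRows : ℕ → List (Maybe ℕ) → PipeDream → List (Maybe ℕ) × List Cell
traceRows i ts [] = [] , []
traceRows i ts (r ∷ rs) =
  let a = traceRow i 1 r ts
      b = traceRows (suc i) (proj₁ (proj₂ a)) rs
  in (proj₁ a ∷ proj₁ b) , (proj₂ (proj₂ a) ++ proj₂ b)

insert : ℕ → List ℕ → List ℕ
insert x [] = x ∷ []
insert x (y ∷ ys) = if x ≤ᵇ y then x ∷ y ∷ ys else y ∷ insert x ys

sort : List ℕ → List ℕ
sort [] = []
sort (x ∷ xs) = insert x (sort xs)

-- pipe a_k (k-th smallest entry of v) enters at the top of column k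
topLabels : List ℕ → List (Maybe ℕ)
topLabels v = map just (sort v)

cellsOf : List ℕ → PipeDream → List Cell
cellsOf v P = proj₂ (traceRows 1 (topLabels v) P)

leftLabels : List ℕ → PipeDream → List (Maybe ℕ)
leftLabels v P = proj₁ (traceRows 1 (topLabels v) P)

Shape : ℕ → PipeDream → Set
Shape m P = map length P ≡ map suc (downFrom m)

AntiDiagBump : ℕ → List Cell → Set
AntiDiagBump m cs = All (λ c → row c + col c ≡ suc m → tile c ≢ cross) cs

SamePair : Cell → Cell → Set
SamePair c d = (top c ≡ top d × right c ≡ right d) ⊎ (top c ≡ right d × right c ≡ top d)

Reduced : List Cell → Set
Reduced cs = ∀ c d → c ∈ cs → d ∈ cs → tile c ≡ cross → tile d ≡ cross →
  SamePair c d → (row c ≡ row d × col c ≡ col d)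

MarksOK : List Cell → Set
MarksOK cs = All (λ c → tile c ≡ mbump →
  Σ ℕ λ a → Σ ℕ λ b → top c ≡ just a × right c ≡ just b ×
    Σ Cell λ d → d ∈ cs × tile d ≡ cross × row d < row c × SamePair c d) cs

IsMRPD : List ℕ → PipeDream → Set
IsMRPD v P = Shape (length v) P × AntiDiagBump (length v) (cellsOf v P) ×
  Reduced (cellsOf v P) × leftLabels v P ≡ map just v × MarksOK (cellsOf v P)

isLbl : Maybe ℕ → ℕ → Bool
isLbl (just a) j = a ≡ᵇ j
isLbl nothing j = false

isCross isBump isMBump : Tile → Bool
isCross cross = true
isCross _ = false
isBump bump = true
isBump _ = false
isMBump mbump = true
isMBump _ = false

-- 1-indexed lookup
nth : {A : Set} → List A → ℕ → Maybe A
nth [] n = nothing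
nth (x ∷ xs) zero = nothing
nth (x ∷ xs) (suc zero) = just x
nth (x ∷ xs) (suc (suc n)) = nth xs (suc n)

tileAt : PipeDream → ℕ → ℕ → Maybe Tile
tileAt P r k with nth P r
... | nothing = nothing
... | just row' = nth row' k

-- column (1-indexed) where pipe j enters: position of j in sorted v
posOf : List ℕ → ℕ → ℕ
posOf [] j = zero
posOf (x ∷ xs) j = if x ≡ᵇ j then 1 else suc (posOf xs j)

colOf : List ℕ → ℕ → ℕ
colOf v j = posOf (sort v) j

columnCells : ℕ → List Cell → List Cell
columnCells k cs = filterᵇ (λ c → col c ≡ᵇ k) cs

-- condition (i): crossing tiles traversed by j, then unmarked bumping tiles only
colPhase2 : List Cell → Bool
colPhase2 [] = true
colPhase2 (c ∷ cs) = isBump (tile c) ∧ colPhase2 cs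

colPhase1 : ℕ → List Cell → Bool
colPhase1 j [] = true
colPhase1 j (c ∷ cs) =
  (isCross (tile c) ∧ isLbl (top c) j ∧ colPhase1 j cs) ∨
  (isBump (tile c) ∧ colPhase2 cs)

traverses : ℕ → Cell → Bool
traverses j c = isLbl (top c) j ∨ isLbl (right c) j

notUnmarkedBump : Maybe Tile → Bool
notUnmarkedBump (just bump) = false
notUnmarkedBump _ = true

allᵇ : {A : Set} → (A → Bool) → List A → Bool
allᵇ p [] = true
allᵇ p (x ∷ xs) = p x ∧ allᵇ p xs

removable? : List ℕ → PipeDream → ℕ → Bool
removable? v P j =
  let cs = cellsOf v P in
  colPhase1 j (columnCells (colOf v j) cs) ∧
  allᵇ (λ c → not (isCross (tile c) ∧ traverses j c) ∨
              notUnmarkedBump (tileAt P (row c ∸ 1) (col c))) cs ∧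
  allᵇ (λ c → not (isMBump (tile c) ∧ traverses j c)) cs

IsCMRPD : List ℕ → PipeDream → Set
IsCMRPD v P = IsMRPD v P × All (λ j → removable? v P j ≡ false) v

tileAt' : PipeDream → ℕ → ℕ → Tile
tileAt' P r k with tileAt P r k
... | just t = t
... | nothing = bump

firstRightCell : ℕ → ℕ → List Cell → Maybe Cell
firstRightCell j k [] = nothing
firstRightCell j k (c ∷ cs) =
  if (col c ≡ᵇ k) ∧ isLbl (right c) j then just c else firstRightCell j k cs

rowIn : ℕ → ℕ → List Cell → ℕ
rowIn j k cs with firstRightCell j k cs
... | just c = row c
... | nothing = zero

crossCase : ℕ → ℕ → List Cell → Bool
crossCase j k cs with firstRightCell j k cs
... | just c = isCross (tile c)
... | nothing = false

phi : List ℕ → ℕ → PipeDream → PipeDream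
phi v j P =
  let m  = length v
      c  = colOf v j
      cs = cellsOf v P
      newTile : ℕ → ℕ → Tile
      newTile r k =
        if c ≤ᵇ k then tileAt' P r (suc k)
        else (if r <ᵇ rowIn j k cs then tileAt' P r k
        else (if crossCase j k cs then tileAt' P (suc r) k
        else (if r ≡ᵇ rowIn j k cs then bump
        else tileAt' P (suc r) k)))
  in map (λ r → map (λ k → newTile r k) (from1 (m ∸ r))) (from1 (m ∸ 1))

deleteLbl : ℕ → List ℕ → List ℕ
deleteLbl j v = filterᵇ (λ x → not (x ≡ᵇ j)) v

applyAll : List ℕ → List ℕ → PipeDream → List ℕ × PipeDream
applyAll v [] P = v , P
applyAll v (j ∷ js) P = applyAll (deleteLbl j v) js (phi v j P)

removablePipes : List ℕ → PipeDream → List ℕ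
removablePipes w P = filterᵇ (removable? w P) w

-- Φ(P) = Φ_{j_k}(⋯Φ_{j_1}(P)⋯), together with the subword it is a pipe dream of
Φ : List ℕ → PipeDream → List ℕ × PipeDream
Φ w P = applyAll w (removablePipes w P) P

{-# OPTIONS --safe #-}

-- Read a pipe dream by columns, from right to left. A column acts on the word u of
-- labels on its right boundary: put its own label, smaller than all others, in front
-- of u and move it down as a pointer; a bump passes the pointer to the next letter, a
-- crossing swaps the current letter with the next one. Reducedness and the condition
-- on marks then say that every crossing swaps an ascent and that every marked bump
-- sits on a descent.
--
-- A pipe j is removable if its own column has crossings followed by unmarked bumps,
-- and in every column to the left it either crosses below a tile that is not an
-- unmarked bump, or passes through two unmarked bumps (the lower one possibly on the
-- antidiagonal). In both cases Φ_j deletes from that column the tile in the row where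
-- j enters. Conversely the row where j leaves a column determines the row where it
-- enters, so the pipe can be reinserted in exactly one way, starting from its position
-- in w. The inserted crossings are ascents: otherwise j crosses some x > j in a column
-- with label a < j, the letter just above j on the left of that column is some b > x,
-- a lies above b, and a b j x is a pattern 1423; such a pattern, up to a change of its
-- smallest letter, persists in the words of all columns to the left and so in w.
-- Finally, removing j does not affect which other pipes are removable.
module Submission where

open import Defs
open import Data.Bool using (Bool; true; false; _∧_; _∨_; not; if_then_else_; T)
open import Data.Bool.Properties using (∨-zeroʳ)
open import Data.Empty using (⊥; ⊥-elim)
open import Data.Fin as Fin using (Fin)
open import Data.List using (List; []; _∷_; _++_; map; length; take; drop; upTo; applyUpTo; lookup)
open import Data.List.Membership.Propositional using (_∈_; _∉_)
open import Data.List.Membership.Propositional.Properties using (∈-++⁻; ∈-++⁺ˡ; ∈-++⁺ʳ)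
open import Data.List.Properties
  using (++-assoc; ++-identityʳ; ∷-injective; map-injective; length-map; map-upTo; map-∘; map-cong)
open import Data.List.Relation.Binary.Permutation.Propositional using (_↭_; ↭-sym; ↭⇒↭ₛ)
open import Data.List.Relation.Binary.Permutation.Setoid.Properties using (Unique-resp-↭)
open import Data.List.Relation.Binary.Sublist.Propositional
  using (_⊆_; []; _∷_; _∷ʳ_; ⊆-refl; ⊆-trans; from∈)
open import Data.List.Relation.Binary.Sublist.Propositional.Properties using (All-resp-⊆; Any-resp-⊆)
open import Data.List.Relation.Unary.All as All using (All; []; _∷_)
open import Data.List.Relation.Unary.All.Properties using (++⁺)
open import Data.List.Relation.Unary.AllPairs using (AllPairs; []; _∷_)
open import Data.List.Relation.Unary.Any using (here; there)
open import Data.List.Relation.Unary.Unique.Propositional using (Unique)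
open import Data.List.Relation.Unary.Unique.Propositional.Properties
  using (upTo⁺) renaming (map⁺ to Unique-map)
open import Data.Maybe using (Maybe; just; nothing)
open import Data.Maybe.Properties using (just-injective)
open import Data.Nat
  using (ℕ; zero; suc; _+_; _∸_; _≤_; _<_; z≤n; s≤s; _≡ᵇ_; _≤ᵇ_; _<ᵇ_; _≟_; _≤?_; _<?_)
open import Data.Nat.Properties
open import Data.List.Membership.DecPropositional _≟_ using (_∈?_)
open import Data.Product using (Σ; _×_; _,_; proj₁; proj₂; ∃₂; ∃-syntax)
open import Data.Sum using (_⊎_; inj₁; inj₂; [_,_]′)
open import Data.Unit using (tt)
open import Function using (_∘_)
open import Relation.Binary.Definitions using (tri<; tri≈; tri>)
open import Relation.Binary.PropositionalEquality
open import Relation.Nullary using (¬_; yes; no; does)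
open import Relation.Nullary.Decidable using (dec-true; dec-false)

variable
  A B : Set
  p : Bool
  a b h i j k m n q r r′ r₁ r₂ s t x y : ℕ
  z z′ : Tile
  C C′ C″ D : List Tile
  u u′ v w as as′ : List ℕ
  Cs Cs′ Cs″ Ds : List (List Tile)

-- Tracing a pipe dream column by column.

Cols : Set
Cols = List (List Tile)

next out : Tile → ℕ → ℕ → ℕ
next cross a h = a
next bump  a h = h
next mbump a h = h
out cross a h = h
out bump  a h = a
out mbump a h = a

-- The list of tiles omits the antidiagonal one: the last `a` leaves through that bump, so the
-- output has one letter more than `u`. For unequal lengths the values are fillers.
run : ℕ → List Tile → List ℕ → List ℕ
run a (z ∷ C) (h ∷ u) = out z a h ∷ run (next z a h) C u
run a (z ∷ C) [] = a ∷ []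
run a [] u = a ∷ []

trace : List ℕ → Cols → List ℕ
trace (a ∷ as) (C ∷ Cs) = run a C (trace as Cs)
trace (a ∷ as) [] = []
trace [] Cs = []

data SameLen {A B : Set} : List A → List B → Set where
  []  : SameLen [] []
  _∷_ : ∀ {xs : List A} {ys : List B} (x : A) {y : B} → SameLen xs ys → SameLen (x ∷ xs) (y ∷ ys)

sameLen : {xs : List A} {ys : List B} → length xs ≡ length ys → SameLen xs ys
sameLen {xs = []} {[]} e = []
sameLen {xs = x ∷ xs} {y ∷ ys} e = x ∷ sameLen (suc-injective e)

length-run : SameLen C u → length (run a C u) ≡ suc (length u)
length-run [] = refl
length-run (z ∷ l) = cong suc (length-run l)

infixr 5 _∷_
-- The staircase without its antidiagonal: each column has as many tiles as there are labels to its
-- right.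
data Tri : List ℕ → Cols → Set where
  []  : Tri [] []
  _∷_ : length C ≡ length as → Tri as Cs → Tri (a ∷ as) (C ∷ Cs)

length-trace : Tri as Cs → length (trace as Cs) ≡ length as
sameLen-trace : Tri as Cs → length C ≡ length as → SameLen C (trace as Cs)
length-trace [] = refl
length-trace (_∷_ {C = C} e T) = trans (length-run (sameLen-trace {C = C} T e)) (cong suc (length-trace T))
sameLen-trace T e = sameLen (trans e (sym (length-trace T)))

∈-run⁻ : SameLen C u → x ∈ run a C u → x ∈ a ∷ u
∈-run⁻ [] x∈ = x∈
∈-run⁻ (cross ∷ l) (here e) = there (here e)
∈-run⁻ (cross ∷ l) (there x∈) with ∈-run⁻ l x∈
... | here e = here e
... | there m = there (there m)
∈-run⁻ (bump ∷ l) (here e) = here e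
∈-run⁻ (bump ∷ l) (there x∈) = there (∈-run⁻ l x∈)
∈-run⁻ (mbump ∷ l) (here e) = here e
∈-run⁻ (mbump ∷ l) (there x∈) = there (∈-run⁻ l x∈)

∈-run⁺ : SameLen C u → x ∈ a ∷ u → x ∈ run a C u
∈-run⁺ [] x∈ = x∈
∈-run⁺ (cross ∷ l) (here e) = there (∈-run⁺ l (here e))
∈-run⁺ (cross ∷ l) (there (here e)) = here e
∈-run⁺ (cross ∷ l) (there (there m)) = there (∈-run⁺ l (there m))
∈-run⁺ (bump ∷ l) (here e) = here e
∈-run⁺ (bump ∷ l) (there m) = there (∈-run⁺ l m)
∈-run⁺ (mbump ∷ l) (here e) = here e
∈-run⁺ (mbump ∷ l) (there m) = there (∈-run⁺ l m)

∈-trace : Tri as Cs → x ∈ trace as Cs → x ∈ as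
∈-trace (e ∷ T) x∈ with ∈-run⁻ (sameLen-trace T e) x∈
... | here e′ = here e′
... | there m = there (∈-trace T m)

-- Local conditions on the tiles.

Inc : List ℕ → Set
Inc = AllPairs _<_

-- The condition on a tile with top label a and right label h: it makes a pipe
-- dream reduced and its marks admissible.
data OK : Tile → ℕ → ℕ → Set where
  cross : a < h → OK cross a h
  bump  : OK bump a h
  mbump : h < a → OK mbump a h

data ColValid : ℕ → List Tile → List ℕ → Set where
  []  : ColValid a [] []
  _∷_ : OK z a h → ColValid (next z a h) C u → ColValid a (z ∷ C) (h ∷ u)

ColValid⇒SameLen : ColValid a C u → SameLen C u
ColValid⇒SameLen [] = []
ColValid⇒SameLen (_∷_ {z = z} o c) = z ∷ ColValid⇒SameLen c

data Valid : List ℕ → Cols → Set where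
  []  : Valid [] []
  _∷_ : ColValid a C (trace as Cs) → Valid as Cs → Valid (a ∷ as) (C ∷ Cs)

-- Threading a removable pipe through the columns.

data Ins {A : Set} : ℕ → A → List A → List A → Set where
  zero : ∀ {x : A} {xs} → Ins 0 x xs (x ∷ xs)
  suc  : ∀ {n} {x y : A} {xs ys} → Ins n x xs ys → Ins (suc n) x (y ∷ xs) (y ∷ ys)

-- ColIns p r r′ C C′: the column C′ arises from C by threading through it a pipe
-- that enters from the right in row r and leaves to the left in row r′ (rows from
-- 0), in the way a removable pipe does; p says whether the tile above is an
-- unmarked bump.
data ColIns : Bool → ℕ → ℕ → List Tile → List Tile → Set where
  crossing : ColIns false 0 0 C (cross ∷ C)
  last     : ColIns p 0 1 [] (bump ∷ [])
  double   : ColIns p 0 1 (bump ∷ C) (bump ∷ bump ∷ C)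
  skip     : ColIns (isBump z) r r′ C C′ → ColIns p (suc r) (suc r′) (z ∷ C) (z ∷ C′)

-- The shape of the entry column in condition (i). The pipe leaves in row `r`, which is the
-- antidiagonal row if there are crossings only.
data Hook : ℕ → List Tile → Set where
  bumps : All (_≡ bump) C → Hook 0 C
  cross : Hook r C → Hook (suc r) (cross ∷ C)

-- The index is the row in which pipe `j` reaches the left boundary. It links the columns: the exit
-- row of one is the entry row of the next one to the left.
data PipeIns (j : ℕ) : ℕ → List ℕ → Cols → List ℕ → Cols → Set where
  enter : Hook r C → PipeIns j r as Cs (j ∷ as) (C ∷ Cs)
  pass  : a ≢ j → PipeIns j r as Cs as′ Cs′ → ColIns false r r′ C C′ →
          PipeIns j r′ (a ∷ as) (C ∷ Cs) (a ∷ as′) (C′ ∷ Cs′)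

Rem : ℕ → List ℕ → Cols → Set
Rem j as′ Cs′ = ∃[ r ] ∃[ as ] ∃[ Cs ] PipeIns j r as Cs as′ Cs′

-- The tile above the exit row decides: under an unmarked bump, the antidiagonal one included, the
-- pipe must have come down through two bumps; otherwise it crosses.
ColIns-exists : ∀ p C r′ → (r′ ≡ 0 → p ≡ false) → r′ ≤ suc (length C) →
                ∃₂ λ r C′ → ColIns p r r′ C C′
ColIns-exists true C zero e l with () ← e refl
ColIns-exists false C zero e l = _ , _ , crossing
ColIns-exists p [] (suc zero) e l = _ , _ , last
ColIns-exists p [] (suc (suc r)) e (s≤s ())
ColIns-exists p (bump ∷ C) (suc zero) e l = _ , _ , double
ColIns-exists p (cross ∷ C) (suc zero) e l =
  let _ , _ , c = ColIns-exists false C 0 (λ _ → refl) z≤n in _ , _ , skip c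
ColIns-exists p (mbump ∷ C) (suc zero) e l =
  let _ , _ , c = ColIns-exists false C 0 (λ _ → refl) z≤n in _ , _ , skip c
ColIns-exists p (z ∷ C) (suc (suc r)) e (s≤s l) =
  let _ , _ , c = ColIns-exists (isBump z) C (suc r) (λ ()) l in _ , _ , skip c

-- A pair of bumps and a crossing never compete for the same exit row, because no crossing is
-- inserted under an unmarked bump.
ColIns-unique : ColIns p r₁ r C C′ → ColIns p r₂ r C C″ → r₁ ≡ r₂ × C′ ≡ C″
ColIns-unique crossing crossing = refl , refl
ColIns-unique last last = refl , refl
ColIns-unique double double = refl , refl
ColIns-unique double (skip ())
ColIns-unique (skip ()) double
ColIns-unique (skip {z = z} c) (skip d) with ColIns-unique c d
... | refl , refl = refl , refl

Hook-unique : Hook r C → Hook r D → length C ≡ length D → C ≡ D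
Hook-unique (bumps []) (bumps []) e = refl
Hook-unique (bumps (refl ∷ cs)) (bumps (refl ∷ ds)) e =
  cong (bump ∷_) (Hook-unique (bumps cs) (bumps ds) (suc-injective e))
Hook-unique (cross c) (cross d) e = cong (cross ∷_) (Hook-unique c d (suc-injective e))

-- The source of injectivity. The pipe is rebuilt from left to right: each exit row fixes the entry
-- row, down to the hook, whose crossings are counted by its row.
PipeIns-unique : PipeIns j r as Cs as′ Cs′ → PipeIns j r as Cs as′ Cs″ →
                 Tri as′ Cs′ → Tri as′ Cs″ → Cs′ ≡ Cs″
PipeIns-unique (enter g) (enter g′) (e ∷ _) (e′ ∷ _) =
  cong (_∷ _) (Hook-unique g g′ (trans e (sym e′)))
PipeIns-unique (enter g) (pass ne _ _) _ _ = ⊥-elim (ne refl)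
PipeIns-unique (pass ne _ _) (enter g) _ _ = ⊥-elim (ne refl)
PipeIns-unique (pass _ P c) (pass _ P′ c′) (e ∷ T) (e′ ∷ T′) with ColIns-unique c c′
... | refl , refl = cong (_ ∷_) (PipeIns-unique P P′ T T′)

ColIns-length : ColIns p r r′ C C′ → length C′ ≡ suc (length C)
ColIns-length crossing = refl
ColIns-length last = refl
ColIns-length double = refl
ColIns-length (skip c) = cong suc (ColIns-length c)

ColIns-in≤ : ColIns p r r′ C C′ → r ≤ length C
ColIns-in≤ crossing = z≤n
ColIns-in≤ last = z≤n
ColIns-in≤ double = z≤n
ColIns-in≤ (skip c) = s≤s (ColIns-in≤ c)

ColIns-out≤ : ColIns p r r′ C C′ → r′ ≤ length C′
ColIns-out≤ crossing = z≤n
ColIns-out≤ last = s≤s z≤n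
ColIns-out≤ double = s≤s z≤n
ColIns-out≤ (skip c) = s≤s (ColIns-out≤ c)

ColIns-true : ColIns true r r′ C C′ → ∃[ s ] r′ ≡ suc s
ColIns-true last = _ , refl
ColIns-true double = _ , refl
ColIns-true (skip c) = _ , refl

ColIns-weaken : ColIns true r r′ C C′ → ColIns p r r′ C C′
ColIns-weaken last = last
ColIns-weaken double = double
ColIns-weaken (skip c) = skip c

Hook-≤ : Hook r C → r ≤ length C
Hook-≤ (bumps _) = z≤n
Hook-≤ (cross g) = s≤s (Hook-≤ g)

PipeIns-out< : PipeIns j r as Cs as′ Cs′ → Tri as′ Cs′ → r < length as′
PipeIns-out< (enter g) (e ∷ T) = s≤s (≤-trans (Hook-≤ g) (≤-reflexive e))
PipeIns-out< (pass _ _ c) (e ∷ T) = s≤s (≤-trans (ColIns-out≤ c) (≤-reflexive e))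

PipeIns-length : PipeIns j r as Cs as′ Cs′ → length as′ ≡ suc (length as)
PipeIns-length (enter g) = refl
PipeIns-length (pass _ P _) = cong suc (PipeIns-length P)

PipeIns-Tri : PipeIns j r as Cs as′ Cs′ → Tri as′ Cs′ → Tri as Cs
PipeIns-Tri (enter g) (e ∷ T) = T
PipeIns-Tri (pass _ P c) (e ∷ T) =
  suc-injective (trans (sym (ColIns-length c)) (trans e (PipeIns-length P))) ∷ PipeIns-Tri P T

-- After the inserted crossing or the second of the two bumps the pointer is what it would be
-- without the pipe, so the output only gains the letter `j`.
ColIns-run : ColIns p r r′ C C′ → SameLen C u → Ins r j u u′ →
             Ins r′ j (run a C u) (run a C′ u′)
ColIns-run crossing l zero = zero
ColIns-run last [] zero = suc zero
ColIns-run double (_ ∷ l) zero = suc zero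
ColIns-run (skip c) (_ ∷ l) (suc q) = suc (ColIns-run c l q)

bumps-run : All (_≡ bump) C → SameLen C u → run a C u ≡ a ∷ u
bumps-run [] [] = refl
bumps-run (refl ∷ bs) (_ ∷ l) = cong (_ ∷_) (bumps-run bs l)

Hook-run : Hook r C → SameLen C u → Ins r j u (run j C u)
Hook-run {j = j} (bumps bs) l = subst (Ins 0 j _) (sym (bumps-run bs l)) zero
Hook-run (cross g) (_ ∷ l) = suc (Hook-run g l)

PipeIns-trace : PipeIns j r as Cs as′ Cs′ → Tri as′ Cs′ →
                Ins r j (trace as Cs) (trace as′ Cs′)
PipeIns-trace (enter g) (e ∷ T) = Hook-run g (sameLen-trace T e)
PipeIns-trace (pass ne P c) T′@(e ∷ T) with PipeIns-Tri (pass ne P c) T′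
... | e₀ ∷ T₀ = ColIns-run c (sameLen-trace T₀ e₀) (PipeIns-trace P T)

ColIns-valid⁻ : ColIns p r r′ C C′ → Ins r j u u′ → ColValid a C′ u′ → ColValid a C u
ColIns-valid⁻ crossing zero (_ ∷ c) = c
ColIns-valid⁻ last zero (_ ∷ []) = []
ColIns-valid⁻ double zero (_ ∷ _ ∷ c) = bump ∷ c
ColIns-valid⁻ (skip c) (suc q) (o ∷ d) = o ∷ ColIns-valid⁻ c q d

PipeIns-valid⁻ : PipeIns j r as Cs as′ Cs′ → Tri as′ Cs′ → Valid as′ Cs′ → Valid as Cs
PipeIns-valid⁻ (enter g) T (_ ∷ V) = V
PipeIns-valid⁻ (pass ne P c) (e ∷ T) (d ∷ V) =
  ColIns-valid⁻ c (PipeIns-trace P T) d ∷ PipeIns-valid⁻ P T V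

-- Two removable pipes do not interfere.

-- Skip m n k: deleting position m moves position n to position k.
data Skip : ℕ → ℕ → ℕ → Set where
  below : Skip 0 (suc n) n
  above : Skip (suc m) 0 0
  suc   : Skip m n k → Skip (suc m) (suc n) (suc k)

-- Both pipes thread `C′`, and the first is deleted. The delicate case is a shared bump: of three
-- consecutive bumps, the antidiagonal counted, two remain, which is again a passage for the second
-- pipe.
ColIns-swap⁻ : ColIns p r r′ C C′ → ColIns p s t D C′ → Skip r s k →
               ∃[ m ] ∃[ E ] (ColIns p k m E C × Skip r′ t m)
ColIns-swap⁻ crossing (skip c) below = _ , _ , c , below
ColIns-swap⁻ double (skip c) below with ColIns-true c
... | _ , refl = _ , _ , ColIns-weaken c , suc below
ColIns-swap⁻ (skip c) crossing above = _ , _ , crossing , above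
ColIns-swap⁻ (skip last) double above = _ , _ , last , suc above
ColIns-swap⁻ (skip double) double above = _ , _ , double , suc above
ColIns-swap⁻ (skip (skip c)) double above = _ , _ , double , suc above
ColIns-swap⁻ (skip c) (skip d) (suc σ) with ColIns-swap⁻ c d σ
... | _ , _ , e , τ = _ , _ , skip e , suc τ

ColIns-swap⁺ : ColIns p r r′ C C′ → ColIns p s t D C →
               ∃[ k ] ∃[ m ] ∃[ E ] (ColIns p k m E C′ × Skip r k s × Skip r′ m t)
ColIns-swap⁺ crossing d = _ , _ , _ , skip d , below , below
ColIns-swap⁺ last ()
ColIns-swap⁺ double last = _ , _ , _ , skip last , below , suc below
ColIns-swap⁺ double double = _ , _ , _ , skip double , below , suc below
ColIns-swap⁺ double (skip d) = _ , _ , _ , skip (skip d) , below , suc below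
ColIns-swap⁺ (skip c) crossing = _ , _ , _ , crossing , above , above
ColIns-swap⁺ (skip last) last = _ , _ , _ , double , above , suc above
ColIns-swap⁺ (skip double) double = _ , _ , _ , double , above , suc above
ColIns-swap⁺ (skip (skip c)) double = _ , _ , _ , double , above , suc above
ColIns-swap⁺ (skip c) (skip d) with ColIns-swap⁺ c d
... | _ , _ , _ , e , σ , τ = _ , _ , _ , skip e , suc σ , suc τ

bumps-Skip : All (_≡ bump) C → ColIns true r r′ D C → r′ ≡ suc r
bumps-Skip bs last = refl
bumps-Skip bs double = refl
bumps-Skip (refl ∷ bs) (skip c) = cong suc (bumps-Skip bs c)

-- Above the turn of the hook the other pipe can only cross and keeps its row; from the turn on it
-- meets bumps and goes down by one. Deleting the hook's own position undoes exactly this shift.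
Hook-Skip : Hook t C → ColIns p r r′ D C → Skip t r′ r
Hook-Skip (bumps bs) last = below
Hook-Skip (bumps bs) double = below
Hook-Skip (bumps (() ∷ bs)) crossing
Hook-Skip (bumps (refl ∷ bs)) (skip c) with bumps-Skip bs c
... | refl = below
Hook-Skip (cross g) crossing = above
Hook-Skip (cross g) (skip c) = suc (Hook-Skip g c)

-- Used when an entry column is put back: it offers a passage in every row, by crossing the
-- descending pipe or, from its turn on, through two bumps.
Hook-row : Hook t C → r < length C → ∃[ r′ ] ∃[ D ] ColIns false r r′ D C
Hook-row (bumps bs) l = let r′ , D , c = go bs l in r′ , D , ColIns-weaken c
  where
  go : All (_≡ bump) C → r < length C → ∃[ r′ ] ∃[ D ] ColIns true r r′ D C
  go {r = zero} (refl ∷ []) l = _ , _ , last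
  go {r = zero} (refl ∷ refl ∷ bs) l = _ , _ , double
  go {r = suc r} (refl ∷ bs) (s≤s l) = let _ , _ , c = go bs l in _ , _ , skip c
Hook-row {r = zero} (cross g) l = _ , _ , crossing
Hook-row {r = suc r} (cross g) (s≤s l) = let _ , _ , c = Hook-row g l in _ , _ , skip c

bumps-del : All (_≡ bump) C′ → ColIns p r r′ C C′ → All (_≡ bump) C × ∃[ s ] r′ ≡ suc s
bumps-del (() ∷ _) crossing
bumps-del bs last = [] , _ , refl
bumps-del (_ ∷ bs) double = bs , _ , refl
bumps-del (e ∷ bs) (skip c) = e ∷ proj₁ (bumps-del bs c) , _ , refl

bumps-ins : All (_≡ bump) C → ColIns true r r′ C C′ → All (_≡ bump) C′
bumps-ins bs last = refl ∷ []
bumps-ins bs double = refl ∷ bs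
bumps-ins (refl ∷ bs) (skip c) = refl ∷ bumps-ins bs c

Hook-del : Hook t C′ → ColIns p r r′ C C′ → ∃[ k ] (Hook k C × Skip r′ t k)
Hook-del (bumps bs) c with bumps-del bs c
... | bs′ , _ , refl = _ , bumps bs′ , above
Hook-del (cross g) crossing = _ , g , below
Hook-del (cross g) (skip c) = let _ , g′ , σ = Hook-del g c in _ , cross g′ , suc σ

-- A crossing inserted no lower than the turn lengthens the descent of the hook. Further down it
-- would lie under an unmarked bump, so only bumps are inserted there.
Hook-ins : Hook t C → ColIns p r r′ C C′ → ∃[ k ] (Hook k C′ × Skip r′ k t)
Hook-ins g crossing = _ , cross g , below
Hook-ins (bumps bs) last = _ , bumps (refl ∷ []) , above
Hook-ins (bumps bs) double = _ , bumps (refl ∷ bs) , above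
Hook-ins (bumps (refl ∷ bs)) (skip c) = _ , bumps (refl ∷ bumps-ins bs c) , above
Hook-ins (cross g) (skip c) = let _ , g′ , σ = Hook-ins g c in _ , cross g′ , suc σ

-- This lemma and `PipeIns-swap⁺` say that deleting `j` neither destroys nor creates the
-- removability of `i`.
PipeIns-swap⁻ : i ≢ j → PipeIns j r as Cs as′ Cs′ → PipeIns i s u Ds as′ Cs′ →
                ∃[ k ] ∃[ v ] ∃[ Es ] (PipeIns i k v Es as Cs × Skip r s k)
PipeIns-swap⁻ ne (enter g) (enter g′) = ⊥-elim (ne refl)
PipeIns-swap⁻ ne (enter g) (pass _ P c) = _ , _ , _ , P , Hook-Skip g c
PipeIns-swap⁻ ne (pass _ P c) (enter g) =
  let _ , g′ , σ = Hook-del g c in _ , _ , _ , enter g′ , σ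
PipeIns-swap⁻ ne (pass _ P c) (pass ne′ Q d) =
  let _ , _ , _ , R , σ = PipeIns-swap⁻ ne P Q
      _ , _ , e , τ = ColIns-swap⁻ c d σ
  in _ , _ , _ , pass ne′ R e , τ

Skip-injective : Skip m n k → Skip m q k → n ≡ q
Skip-injective below below = refl
Skip-injective above above = refl
Skip-injective (suc σ) (suc τ) = cong suc (Skip-injective σ τ)

PipeIns-swap⁺ : i ≢ j → PipeIns j r as Cs as′ Cs′ → Tri as′ Cs′ → PipeIns i s u Ds as Cs →
                ∃[ k ] ∃[ v ] ∃[ Es ] (PipeIns i k v Es as′ Cs′ × Skip r k s)
PipeIns-swap⁺ ne (enter g) (e ∷ T) P =
  let _ , _ , c = Hook-row g (≤-trans (PipeIns-out< P T) (≤-reflexive (sym e)))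
  in _ , _ , _ , pass (ne ∘ sym) P c , Hook-Skip g c
PipeIns-swap⁺ ne (pass _ P c) T (enter g) =
  let _ , g′ , σ = Hook-ins g c in _ , _ , _ , enter g′ , σ
PipeIns-swap⁺ ne (pass _ P c) (e ∷ T) (pass ne′ Q d)
  with PipeIns-swap⁺ ne P T Q | ColIns-swap⁺ c d
-- The column yields its own entry row for `i`; injectivity identifies it with the row in which the
-- rest of the pipe arrives.
... | _ , _ , _ , R , σ | _ , _ , _ , f , τ , τ′ with Skip-injective σ τ
... | refl = _ , _ , _ , pass ne′ R f , τ′

Rem-del : i ≢ j → PipeIns j r as Cs as′ Cs′ → Rem i as′ Cs′ → Rem i as Cs
Rem-del ne P (_ , _ , _ , Q) = let _ , _ , _ , R , _ = PipeIns-swap⁻ ne P Q in _ , _ , _ , R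

Rem-ins : i ≢ j → PipeIns j r as Cs as′ Cs′ → Tri as′ Cs′ → Rem i as Cs → Rem i as′ Cs′
Rem-ins ne P T (_ , _ , _ , Q) = let _ , _ , _ , R , _ = PipeIns-swap⁺ ne P T Q in _ , _ , _ , R

-- Reinserting a pipe when 1423 is avoided.

-- Pat j x l: l contains a letter below j followed by one above x, the letters
-- "1" and "4" of a pattern 1423 whose "2" and "3" are j and x.
data Pat (j x : ℕ) : List ℕ → Set where
  here  : a < j → b ∈ v → x < b → Pat j x (a ∷ v)
  there : Pat j x v → Pat j x (y ∷ v)

-- The first half of a pattern, completed to `Pat` when a letter above `x` is written after it.
data Small (j : ℕ) : List ℕ → Set where
  here  : a < j → Small j (a ∷ v)
  there : Small j v → Small j (y ∷ v)

Pat⇒∈ : Pat j x v → ∃[ b ] (b ∈ v × x < b)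
Pat⇒∈ (here _ b∈ l) = _ , there b∈ , l
Pat⇒∈ (there P) = let b , b∈ , l = Pat⇒∈ P in b , there b∈ , l

∈-∷ʳ : ∀ v → x ∈ v ++ x ∷ w
∈-∷ʳ [] = here refl
∈-∷ʳ (_ ∷ v) = there (∈-∷ʳ v)

Small-++ : Small j v → Small j (v ++ w)
Small-++ (here l) = here l
Small-++ (there P) = there (Small-++ P)

Small-∷ʳ : ∀ v → a < j → Small j (v ++ a ∷ [])
Small-∷ʳ [] l = here l
Small-∷ʳ (_ ∷ v) l = there (Small-∷ʳ v l)

Pat-∷ʳ : Small j v → x < b → Pat j x (v ++ b ∷ [])
Pat-∷ʳ {v = _ ∷ v} (here l) l′ = here l (∈-∷ʳ v) l′
Pat-∷ʳ (there P) l = there (Pat-∷ʳ P l)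

-- With `j` placed in row `r` of `u`, the word `w ++ u` shows no 1423 in which `j` is the 2, the 3
-- lies below it, and the 1 and 4 lie above it.
NoPat : ℕ → ℕ → List ℕ → List ℕ → Set
NoPat j r w u = ∀ x → j < x → x ∈ drop r u → Pat j x (w ++ take r u) → ⊥

NoPat-step : ∀ w → NoPat j (suc r) w (a ∷ u) → NoPat j r (w ++ a ∷ []) u
NoPat-step {r = r} {a} {u} w N x l x∈ P =
  N x l x∈ (subst (Pat _ x) (++-assoc w (a ∷ []) (take r u)) P)

-- The list w is the part of the output above the current tile. A pipe that is
-- about to be crossed below a crossing or a marked bump either still is the pipe
-- of the column, hence below j, or was preceded there by a larger label.
ColIns-valid⁺ : ∀ w → ColIns p r r′ C C′ → ColValid a C u → Ins r j u u′ → j ∉ a ∷ u →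
                (p ≡ false → a < j ⊎ Pat j a w) → a < j ⊎ Small j w →
                NoPat j r′ w (run a C u) → ColValid a C′ u′
ColIns-valid⁺ {a = a} {j = j} w crossing c zero j∉ P S N with P refl
... | inj₁ l = cross l ∷ c
... | inj₂ Q with <-cmp a j
... | tri< l _ _ = cross l ∷ c
... | tri≈ _ e _ = ⊥-elim (j∉ (here (sym e)))
-- The label `a` leaves the column below `j` and is the 3 of a pattern whose 1 and 4 have been
-- written to `w`.
... | tri> _ _ l =
  ⊥-elim (N a l (∈-run⁺ (ColValid⇒SameLen c) (here refl)) (subst (Pat j a) (sym (++-identityʳ w)) Q))
ColIns-valid⁺ w last [] zero j∉ P S N = bump ∷ []
ColIns-valid⁺ w double (_ ∷ c) zero j∉ P S N = bump ∷ bump ∷ c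
ColIns-valid⁺ w (skip ci) (cross l ∷ c) (suc q) j∉ P S N =
  cross l ∷ ColIns-valid⁺ (w ++ _ ∷ []) ci c q
    (λ { (here e) → j∉ (here e) ; (there m) → j∉ (there (there m)) })
    (λ _ → [ inj₁ , (λ s → inj₂ (Pat-∷ʳ s l)) ]′ S)
    ([ inj₁ , (λ s → inj₂ (Small-++ s)) ]′ S) (NoPat-step w N)
ColIns-valid⁺ w (skip ci) (bump ∷ c) (suc q) j∉ P S N =
  bump ∷ ColIns-valid⁺ (w ++ _ ∷ []) ci c q (j∉ ∘ there) (λ ())
    (inj₂ ([ Small-∷ʳ w , Small-++ ]′ S)) (NoPat-step w N)
ColIns-valid⁺ w (skip ci) (mbump l ∷ c) (suc q) j∉ P S N =
  mbump l ∷ ColIns-valid⁺ (w ++ _ ∷ []) ci c q (j∉ ∘ there)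
    (λ _ → [ (λ l′ → inj₁ (<-trans l l′)) , (λ s → inj₂ (Pat-∷ʳ s l)) ]′ S)
    (inj₂ ([ Small-∷ʳ w , Small-++ ]′ S)) (NoPat-step w N)

∈-drop-run : ColIns p r r′ C C′ → SameLen C u → x ∈ drop r u → x ∈ drop r′ (run a C u)
∈-drop-run crossing l x∈ = ∈-run⁺ l (there x∈)
∈-drop-run last [] ()
∈-drop-run double (_ ∷ l) x∈ = ∈-run⁺ l x∈
∈-drop-run (skip c) (_ ∷ l) x∈ = ∈-drop-run c l x∈

-- Only the letter that crosses `j` gets below it, and in a valid column that letter is smaller than
-- `j`.
∈-take-run : ColIns p r r′ C C′ → Ins r j u u′ → ColValid a C′ u′ → SameLen C u →
             b ∈ a ∷ take r u → j < b → b ∈ take r′ (run a C u)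
∈-take-run crossing zero (cross l ∷ _) _ (here refl) l′ = ⊥-elim (<-asym l l′)
∈-take-run last zero c [] (here e) l′ = here e
∈-take-run double zero c (_ ∷ _) (here e) l′ = here e
∈-take-run (skip ci) (suc q) (cross _ ∷ c) (_ ∷ s) (here e) l = there (∈-take-run ci q c s (here e) l)
∈-take-run (skip ci) (suc q) (cross _ ∷ c) (_ ∷ s) (there (here e)) l = here e
∈-take-run (skip ci) (suc q) (cross _ ∷ c) (_ ∷ s) (there (there m)) l =
  there (∈-take-run ci q c s (there m) l)
∈-take-run (skip ci) (suc q) (bump ∷ c) (_ ∷ s) (here e) l = here e
∈-take-run (skip ci) (suc q) (bump ∷ c) (_ ∷ s) (there m) l = there (∈-take-run ci q c s m l)
∈-take-run (skip ci) (suc q) (mbump _ ∷ c) (_ ∷ s) (here e) l = here e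
∈-take-run (skip ci) (suc q) (mbump _ ∷ c) (_ ∷ s) (there m) l = there (∈-take-run ci q c s m l)

-- A crossing writes out the next letter and keeps the pointer, so the search goes on. At a bump the
-- pointer `a`, itself below `j`, is written out and becomes the new letter 1 of the pattern.
Pat-take-run : ColIns p r r′ C C′ → Ins r j u u′ → ColValid a C′ u′ → SameLen C u →
               a < j → j < x → Pat j x (take r u) → Pat j x (take r′ (run a C u))
Pat-take-run (skip ci) (suc q) (cross _ ∷ c) (_ ∷ s) la lx (here l b∈ lb) =
  here l (∈-take-run ci q c s (there b∈) (<-trans lx lb)) lb
Pat-take-run (skip ci) (suc q) (cross _ ∷ c) (_ ∷ s) la lx (there P) =
  there (Pat-take-run ci q c s la lx P)
Pat-take-run (skip ci) (suc q) (bump ∷ c) (_ ∷ s) la lx P =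
  let _ , b∈ , lb = Pat⇒∈ P in here la (∈-take-run ci q c s b∈ (<-trans lx lb)) lb
Pat-take-run (skip ci) (suc q) (mbump _ ∷ c) (_ ∷ s) la lx P =
  let _ , b∈ , lb = Pat⇒∈ P in here la (∈-take-run ci q c s b∈ (<-trans lx lb)) lb

Hook-exists : ∀ n r → r ≤ n → ∃[ C ] (Hook r C × length C ≡ n)
Hook-exists zero zero l = [] , bumps [] , refl
Hook-exists (suc n) zero l with Hook-exists n zero z≤n
... | C , bumps bs , e = bump ∷ C , bumps (refl ∷ bs) , cong suc e
Hook-exists (suc n) (suc r) (s≤s l) =
  let C , g , e = Hook-exists n r l in cross ∷ C , cross g , cong suc e

Hook-valid : Hook r C → SameLen C u → (∀ {x} → x ∈ u → j < x) → ColValid j C u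
Hook-valid (bumps bs) l f = go bs l
  where
  go : All (_≡ bump) C → SameLen C u → ColValid a C u
  go [] [] = []
  go (refl ∷ bs) (_ ∷ l) = bump ∷ go bs l
Hook-valid (cross g) (_ ∷ l) f = cross (f (here refl)) ∷ Hook-valid g l (f ∘ there)

Ins-here : Ins n j u u′ → j ∈ u′
Ins-here zero = here refl
Ins-here (suc q) = there (Ins-here q)

Ins-∉ : Ins n j u u′ → Inc u′ → j ∉ u
Ins-∉ zero (l ∷ I) j∈ = <-irrefl refl (All.lookup l j∈)
Ins-∉ (suc q) (l ∷ I) (here refl) = <-irrefl refl (All.lookup l (Ins-here q))
Ins-∉ (suc q) (l ∷ I) (there m) = Ins-∉ q I m

Ins-exists : {xs : List A} {x : A} → n ≤ length xs → ∃[ ys ] Ins n x xs ys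
Ins-exists {n = zero} l = _ , zero
Ins-exists {n = suc n} {xs = x ∷ xs} (s≤s l) = let _ , q = Ins-exists l in _ , suc q

∉-shorter : Ins n j as as′ → Inc (a ∷ as′) → Tri as Cs → j ∉ a ∷ trace as Cs
∉-shorter q (l ∷ I) T (here refl) = <-irrefl refl (All.lookup l (Ins-here q))
∉-shorter q (l ∷ I) T (there m) = Ins-∉ q I (∈-trace T m)

-- The columns are threaded from left to right, starting with the prescribed exit row. A pattern to
-- the right of a column would reappear on its left, so `NoPat` is passed on to the remaining
-- columns.
PipeIns-exists : Ins n j as as′ → Inc as′ → Tri as Cs → Valid as Cs →
                 r ≤ length as → NoPat j r [] (trace as Cs) →
                 ∃[ Cs′ ] (PipeIns j r as Cs as′ Cs′ × Tri as′ Cs′ × Valid as′ Cs′)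
PipeIns-exists {as = as} {r = r} zero (l ∷ I) T V r≤ N =
  let C , g , e = Hook-exists (length as) r r≤
  in _ , enter g , e ∷ T ,
     Hook-valid g (sameLen-trace T e) (λ x∈ → All.lookup l (∈-trace T x∈)) ∷ V
PipeIns-exists {j = j} {r = r} (suc q) I′@(l ∷ I) (_∷_ {C = C} e T) (c ∷ V) r≤ N
  with ColIns-exists false C r (λ _ → refl) (≤-trans r≤ (s≤s (≤-reflexive (sym e))))
... | s , C′ , ci
  -- The word with `j` in row `s` is formed directly: the validity of `C′` against it is needed to
  -- justify the recursive call, which has not yet produced the right-hand part of the pipe.
  with u₀ , q₀ ← Ins-exists (≤-trans (ColIns-in≤ ci) (≤-reflexive (trans e (sym (length-trace T)))))
  with Cs′ , P , T′ , V′ ← PipeIns-exists q I T V (≤-trans (ColIns-in≤ ci) (≤-reflexive e))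
         (λ x j<x x∈ Q → N x j<x (∈-drop-run ci (sameLen-trace T e) x∈)
           (Pat-take-run ci q₀ (ColIns-valid⁺ [] ci c q₀ (∉-shorter q I′ T) (λ _ → inj₁ (All.lookup l (Ins-here q)))
                                 (inj₁ (All.lookup l (Ins-here q))) N)
             (sameLen-trace T e) (All.lookup l (Ins-here q)) j<x Q))
  = _ , pass (<⇒≢ (All.lookup l (Ins-here q))) P ci ,
    trans (ColIns-length ci) (trans (cong suc e) (sym (PipeIns-length P))) ∷ T′ ,
    ColIns-valid⁺ [] ci c (PipeIns-trace P T′) (∉-shorter q I′ T) (λ _ → inj₁ (All.lookup l (Ins-here q)))
      (inj₁ (All.lookup l (Ins-here q))) N ∷ V′

-- Crossings and inversions

data Meet : ℕ → List Tile → List ℕ → ℕ → ℕ → Tile → ℕ → Set where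
  here  : Meet a (z ∷ C) (h ∷ u) 0 a z h
  there : Meet (next z a h) C u r s z′ b → Meet a (z ∷ C) (h ∷ u) (suc r) s z′ b

-- PipeMeet k as Cs r s z b: the tile in row r, column k (both from 0) is z, with
-- top label s and right label b.
data PipeMeet : ℕ → List ℕ → Cols → ℕ → ℕ → Tile → ℕ → Set where
  here  : Meet a C (trace as Cs) r s z b → PipeMeet 0 (a ∷ as) (C ∷ Cs) r s z b
  there : PipeMeet k as Cs r s z b → PipeMeet (suc k) (a ∷ as) (C ∷ Cs) r s z b

data At : List ℕ → ℕ → ℕ → Set where
  here  : At (x ∷ u) 0 x
  there : At u n x → At (y ∷ u) (suc n) x

At⇒∈ : At u n x → x ∈ u
At⇒∈ here = here refl
At⇒∈ (there m) = there (At⇒∈ m)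

Ins⇒At : Ins n x u v → At v n x
Ins⇒At zero = here
Ins⇒At (suc q) = there (Ins⇒At q)

∉-All : All (x ≢_) u → x ∉ u
∉-All a x∈ = All.lookup a x∈ refl

At-unique : Unique u → At u m x → At u n x → m ≡ n
At-unique U here here = refl
At-unique (d ∷ U) here (there q) = ⊥-elim (∉-All d (At⇒∈ q))
At-unique (d ∷ U) (there p) here = ⊥-elim (∉-All d (At⇒∈ p))
At-unique (d ∷ U) (there p) (there q) = cong suc (At-unique U p q)

Unique-next : Unique (a ∷ h ∷ u) → Unique (next z a h ∷ u)
Unique-next {z = cross} ((_ ∷ d) ∷ _ ∷ U) = d ∷ U
Unique-next {z = bump} (_ ∷ U) = U
Unique-next {z = mbump} (_ ∷ U) = U

out∉ : Unique (a ∷ h ∷ u) → out z a h ∉ next z a h ∷ u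
out∉ {z = cross} ((d ∷ _) ∷ _) (here e) = d (sym e)
out∉ {z = cross} (_ ∷ d ∷ _) (there m) = ∉-All d m
out∉ {z = bump} (d ∷ _) m = ∉-All d m
out∉ {z = mbump} (d ∷ _) m = ∉-All d m

Unique-run : SameLen C u → Unique (a ∷ u) → Unique (run a C u)
Unique-run [] U = U
Unique-run (_∷_ z l) U =
  All.tabulate (λ { m refl → out∉ {z = z} U (∈-run⁻ l m) }) ∷ Unique-run l (Unique-next {z = z} U)

Inc⇒Unique : Inc as → Unique as
Inc⇒Unique [] = []
Inc⇒Unique (l ∷ I) = All.map <⇒≢ l ∷ Inc⇒Unique I

Unique-head : Inc (a ∷ as) → Tri as Cs → Unique (trace as Cs) → Unique (a ∷ trace as Cs)
Unique-head (l ∷ I) T U = All.tabulate (λ m → <⇒≢ (All.lookup l (∈-trace T m))) ∷ U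

Unique-trace : Inc as → Tri as Cs → Unique (trace as Cs)
Unique-trace [] [] = []
Unique-trace (l ∷ I) (e ∷ T) =
  Unique-run (sameLen-trace T e) (Unique-head (l ∷ I) T (Unique-trace I T))

Meet-right : Meet a C u r s z b → At u r b
Meet-right here = here
Meet-right (there m) = there (Meet-right m)

Meet-top : Meet a C u r s z b → s ≡ a ⊎ ∃[ n ] (At u n s × n < r)
Meet-top here = inj₁ refl
Meet-top (there {z = z} m) with Meet-top m
Meet-top (there {z = cross} m) | inj₁ e = inj₁ e
Meet-top (there {z = bump} m) | inj₁ refl = inj₂ (_ , here , s≤s z≤n)
Meet-top (there {z = mbump} m) | inj₁ refl = inj₂ (_ , here , s≤s z≤n)
... | inj₂ (_ , p , l) = inj₂ (_ , there p , s≤s l)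

Meet-top∈ : Meet a C u r s z b → s ∈ a ∷ u
Meet-top∈ m with Meet-top m
... | inj₁ e = here e
... | inj₂ (_ , p , _) = there (At⇒∈ p)

PipeMeet-∈ : Tri as Cs → PipeMeet k as Cs r s z b → (x ≡ s ⊎ x ≡ b) → x ∈ as
PipeMeet-∈ (e ∷ T) (here m) (inj₁ refl) with Meet-top∈ m
... | here e′ = here e′
... | there x∈ = there (∈-trace T x∈)
PipeMeet-∈ (e ∷ T) (here m) (inj₂ refl) = there (∈-trace T (At⇒∈ (Meet-right m)))
PipeMeet-∈ (e ∷ T) (there m) q = there (PipeMeet-∈ T m q)

Meet-OK : ColValid a C u → Meet a C u r s z b → OK z s b
Meet-OK (o ∷ c) here = o
Meet-OK (o ∷ c) (there m) = Meet-OK c m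

PipeMeet-OK : Valid as Cs → PipeMeet k as Cs r s z b → OK z s b
PipeMeet-OK (c ∷ V) (here m) = Meet-OK c m
PipeMeet-OK (c ∷ V) (there m) = PipeMeet-OK V m

colValid : SameLen C u → (∀ {r s z b} → Meet a C u r s z b → OK z s b) → ColValid a C u
colValid [] f = []
colValid (z ∷ l) f = f here ∷ colValid l (f ∘ there)

origin : SameLen C u → At (run a C u) n y → y ≡ a ⊎ ∃[ m ] (At u m y × m ≤ n)
origin [] here = inj₁ refl
origin (cross ∷ l) here = inj₂ (_ , here , z≤n)
origin (bump ∷ l) here = inj₁ refl
origin (mbump ∷ l) here = inj₁ refl
origin (z ∷ l) (there p) with origin l p
origin (cross ∷ l) (there p) | inj₁ e = inj₁ e
origin (bump ∷ l) (there p) | inj₁ refl = inj₂ (_ , here , z≤n)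
origin (mbump ∷ l) (there p) | inj₁ refl = inj₂ (_ , here , z≤n)
... | inj₂ (_ , q , i) = inj₂ (_ , there q , s≤s i)

-- Two letters leave in the order in which they arrive, the pointer counting as the topmost, unless
-- they cross in this column.
run-order : SameLen C u → At (run a C u) m x → At (run a C u) n y → m < n →
            (∃[ r ] (Meet a C u r y cross x × r < n)) ⊎
            (∃[ k ] ((x ≡ a ⊎ ∃[ i ] (At u i x × i < k)) × At u k y × k ≤ n))
run-order [] here here ()
run-order [] here (there ()) l
run-order [] (there ()) q l
run-order (z ∷ l) p here ()
run-order (cross ∷ l) here (there q) i with origin l q
... | inj₁ refl = inj₁ (_ , here , i)
... | inj₂ (_ , q′ , i′) = inj₂ (_ , inj₂ (_ , here , s≤s z≤n) , there q′ , s≤s i′)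
run-order (bump ∷ l) here (there q) i with origin l q
... | inj₁ refl = inj₂ (_ , inj₁ refl , here , z≤n)
... | inj₂ (_ , q′ , i′) = inj₂ (_ , inj₁ refl , there q′ , s≤s i′)
run-order (mbump ∷ l) here (there q) i with origin l q
... | inj₁ refl = inj₂ (_ , inj₁ refl , here , z≤n)
... | inj₂ (_ , q′ , i′) = inj₂ (_ , inj₁ refl , there q′ , s≤s i′)
run-order (z ∷ l) (there p) (there q) (s≤s i) with run-order l p q i
... | inj₁ (_ , m , i′) = inj₁ (_ , there m , s≤s i′)
run-order (z ∷ l) (there p) (there q) (s≤s i) | inj₂ (_ , inj₂ (_ , p′ , i″) , q′ , i′) =
  inj₂ (_ , inj₂ (_ , there p′ , s≤s i″) , there q′ , s≤s i′)
run-order (cross ∷ l) (there p) (there q) (s≤s i) | inj₂ (_ , inj₁ e , q′ , i′) =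
  inj₂ (_ , inj₁ e , there q′ , s≤s i′)
run-order (bump ∷ l) (there p) (there q) (s≤s i) | inj₂ (_ , inj₁ refl , q′ , i′) =
  inj₂ (_ , inj₂ (_ , here , s≤s z≤n) , there q′ , s≤s i′)
run-order (mbump ∷ l) (there p) (there q) (s≤s i) | inj₂ (_ , inj₁ refl , q′ , i′) =
  inj₂ (_ , inj₂ (_ , here , s≤s z≤n) , there q′ , s≤s i′)

-- The inverted order is followed to the right until the two pipes cross. It cannot begin with the
-- label of a column, which is smaller than every label to its right.
inversion⇒crossing : Inc as → Tri as Cs → At (trace as Cs) m x → At (trace as Cs) n y →
                     m < n → y < x → ∃[ k ] ∃[ r ] (PipeMeet k as Cs r y cross x × r < n)
inversion⇒crossing (l ∷ I) (e ∷ T) p q i y<x with run-order (sameLen-trace T e) p q i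
... | inj₁ (_ , m , i′) = _ , _ , here m , i′
... | inj₂ (_ , inj₁ refl , q′ , _) =
  ⊥-elim (<-asym y<x (All.lookup l (∈-trace T (At⇒∈ q′))))
... | inj₂ (_ , inj₂ (_ , p′ , i″) , q′ , i′) =
  let _ , _ , m , i‴ = inversion⇒crossing I T p′ q′ i″ y<x
  in _ , _ , there m , <-≤-trans i‴ i′

data Before (x y : ℕ) : List ℕ → Set where
  here  : y ∈ v → Before x y (x ∷ v)
  there : Before x y v → Before x y (k ∷ v)

Before-At : Unique u → Before x y u → At u m y → At u n x → ¬ (m < n)
Before-At (d ∷ U) (here y∈) here q l = ∉-All d y∈
Before-At (d ∷ U) (here y∈) (there p) (there q) l = ∉-All d (At⇒∈ q)
Before-At (d ∷ U) (there B) here q l = ∉-All d (before∈ B)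
  where
  before∈ : Before x y u → y ∈ u
  before∈ (here m) = there m
  before∈ (there B) = there (before∈ B)
Before-At (d ∷ U) (there B) (there p) (there q) (s≤s l) = Before-At U B p q l

run-inverts : SameLen C u → Meet a C u r s cross b → Before b s (run a C u)
run-inverts (_ ∷ l) here = here (∈-run⁺ l (here refl))
run-inverts (_ ∷ l) (there m) = there (run-inverts l m)

-- A valid crossing swaps an ascent, so no inversion is ever undone.
run-keeps : ColValid a C u → y < x → Before x y (a ∷ u) → Before x y (run a C u)
run-keeps [] i B = B
run-keeps (cross o ∷ c) i (here (here refl)) = ⊥-elim (<-asym i o)
run-keeps (cross o ∷ c) i (here (there m)) = there (run-keeps c i (here m))
run-keeps (cross o ∷ c) i (there (here m)) = here (∈-run⁺ (ColValid⇒SameLen c) (there m))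
run-keeps (cross o ∷ c) i (there (there B)) = there (run-keeps c i (there B))
run-keeps (bump ∷ c) i (here m) = here (∈-run⁺ (ColValid⇒SameLen c) m)
run-keeps (bump ∷ c) i (there B) = there (run-keeps c i B)
run-keeps (mbump o ∷ c) i (here m) = here (∈-run⁺ (ColValid⇒SameLen c) m)
run-keeps (mbump o ∷ c) i (there B) = there (run-keeps c i B)

cross-< : OK cross a h → a < h
cross-< (cross l) = l

crossing⇒inversion : Valid as Cs → PipeMeet k as Cs r s cross b → Before b s (trace as Cs)
crossing⇒inversion (c ∷ V) (here m) = run-inverts (ColValid⇒SameLen c) m
crossing⇒inversion (c ∷ V) (there m) =
  run-keeps c (cross-< (PipeMeet-OK V m)) (there (crossing⇒inversion V m))

SameLabels : ℕ → ℕ → ℕ → ℕ → Set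
SameLabels s b s′ b′ = (s ≡ s′ × b ≡ b′) ⊎ (s ≡ b′ × b ≡ s′)

CrossOnce : List ℕ → Cols → Set
CrossOnce as Cs = ∀ {k r s b k′ r′ s′ b′} → PipeMeet k as Cs r s cross b →
  PipeMeet k′ as Cs r′ s′ cross b′ → SameLabels s b s′ b′ → r ≡ r′ × k ≡ k′

MarkedCrossAbove : List ℕ → Cols → Set
MarkedCrossAbove as Cs = ∀ {k r s b} → PipeMeet k as Cs r s mbump b →
  ∃[ k′ ] ∃[ r′ ] ∃[ s′ ] ∃[ b′ ]
    (PipeMeet k′ as Cs r′ s′ cross b′ × r′ < r × SameLabels s b s′ b′)

Inc-∉ : Inc (a ∷ as) → a ∉ as
Inc-∉ (l ∷ I) m = <-irrefl refl (All.lookup l m)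

-- Having crossed, the two pipes reach this column with `b` above `s`, whereas the top label of a
-- tile comes from above its right label.
no-meeting-in-order : Inc (a ∷ as) → Tri as Cs → Valid as Cs → Meet a C (trace as Cs) r s z b →
                      PipeMeet k as Cs r′ s cross b → ⊥
no-meeting-in-order I@(_ ∷ I′) T V m m′ with Meet-top m
... | inj₁ refl = Inc-∉ I (PipeMeet-∈ T m′ (inj₁ refl))
... | inj₂ (_ , p , l) =
  Before-At (Unique-trace I′ T) (crossing⇒inversion V m′) p (Meet-right m) l

Valid⇒CrossOnce : Inc as → Tri as Cs → Valid as Cs → CrossOnce as Cs
Valid⇒CrossOnce (_ ∷ I) (e ∷ T) (c ∷ V) (here m) (here m′) (inj₁ (refl , refl)) =
  At-unique (Unique-trace I T) (Meet-right m) (Meet-right m′) , refl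
Valid⇒CrossOnce I (e ∷ T) (c ∷ V) (here m) (there m′) (inj₁ (refl , refl)) =
  ⊥-elim (no-meeting-in-order I T V m m′)
Valid⇒CrossOnce I (e ∷ T) (c ∷ V) (there m) (here m′) (inj₁ (refl , refl)) =
  ⊥-elim (no-meeting-in-order I T V m′ m)
Valid⇒CrossOnce (_ ∷ I) (e ∷ T) (c ∷ V) (there m) (there m′) (inj₁ q) =
  let e₁ , e₂ = Valid⇒CrossOnce I T V m m′ (inj₁ q) in e₁ , cong suc e₂
Valid⇒CrossOnce I T V m m′ (inj₂ (refl , refl)) =
  ⊥-elim (<-asym (cross-< (PipeMeet-OK V m)) (cross-< (PipeMeet-OK V m′)))

inverted⇒crossing : Inc (a ∷ as) → Tri as Cs → Meet a C (trace as Cs) r s z b → b < s →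
                    ∃[ k ] ∃[ r′ ] (PipeMeet k as Cs r′ b cross s × r′ < r)
inverted⇒crossing (l ∷ I) T m b<s with Meet-top m
... | inj₁ refl = ⊥-elim (<-asym b<s (All.lookup l (∈-trace T (At⇒∈ (Meet-right m)))))
... | inj₂ (_ , p , i) = inversion⇒crossing I T p (Meet-right m) i b<s

Valid⇒MarkedCrossAbove : Inc as → Tri as Cs → Valid as Cs → MarkedCrossAbove as Cs
Valid⇒MarkedCrossAbove I (e ∷ T) (c ∷ V) (here m) with Meet-OK c m
... | mbump b<s =
  let _ , _ , m′ , l = inverted⇒crossing I T m b<s
  in _ , _ , _ , _ , there m′ , l , inj₂ (refl , refl)
Valid⇒MarkedCrossAbove (_ ∷ I) (e ∷ T) (c ∷ V) (there m) =
  let _ , _ , _ , _ , m′ , q = Valid⇒MarkedCrossAbove I T V m in _ , _ , _ , _ , there m′ , q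

-- Pipes only move down.
Meet-≤ : Unique (a ∷ u) → SameLen C u → Meet a C u r s z b → x ≡ s ⊎ x ≡ b →
         At (run a C u) n x → r ≤ n
Meet-≤ U l here q p = z≤n
Meet-≤ U (_ ∷ l) (there {z = z} m) (inj₁ refl) here = ⊥-elim (out∉ {z = z} U (Meet-top∈ m))
Meet-≤ U (_ ∷ l) (there {z = z} m) (inj₂ refl) here =
  ⊥-elim (out∉ {z = z} U (there (At⇒∈ (Meet-right m))))
Meet-≤ U (_ ∷ l) (there {z = z} m) q (there p) = s≤s (Meet-≤ (Unique-next {z = z} U) l m q p)

PipeMeet-≤ : Inc as → Tri as Cs → PipeMeet k as Cs r s z b → x ≡ s ⊎ x ≡ b →
             At (trace as Cs) n x → r ≤ n
PipeMeet-≤ I@(_ ∷ I′) (e ∷ T) (here m) q p =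
  Meet-≤ (Unique-head I T (Unique-trace I′ T)) (sameLen-trace T e) m q p
PipeMeet-≤ I@(_ ∷ I′) (e ∷ T) (there m) q p with origin (sameLen-trace T e) p
... | inj₁ refl = ⊥-elim (Inc-∉ I (PipeMeet-∈ T m q))
... | inj₂ (_ , p′ , l) = ≤-trans (PipeMeet-≤ I′ T m q p′) l

-- The leftmost column comes later on both pipes. Since pipes only move down, a crossing there
-- cannot be above a mark further right.
MarkedCrossAbove-tail : Inc (a ∷ as) → Tri (a ∷ as) (C ∷ Cs) →
                        MarkedCrossAbove (a ∷ as) (C ∷ Cs) → MarkedCrossAbove as Cs
MarkedCrossAbove-tail (_ ∷ I) (e ∷ T) M m with M (there m)
... | _ , _ , _ , _ , there m′ , q = _ , _ , _ , _ , m′ , q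
... | _ , _ , _ , _ , here m′ , l , q =
  ⊥-elim (<⇒≱ l (PipeMeet-≤ I T m (label q) (Meet-right m′)))
  where
  label : SameLabels s b t x → x ≡ s ⊎ x ≡ b
  label (inj₁ (_ , e)) = inj₂ (sym e)
  label (inj₂ (e , _)) = inj₁ (sym e)

-- By induction the columns to the right are valid, so there an inversion amounts to an earlier
-- crossing. Hence a crossing at a descent would be a second crossing of its pair, and a mark at an
-- ascent would have no crossing above it.
valid : Inc as → Tri as Cs → CrossOnce as Cs → MarkedCrossAbove as Cs → Valid as Cs
valid [] [] R M = []
valid {as = a ∷ as} {Cs = C ∷ Cs} I@(l ∷ I′) T@(e ∷ T′) R M =
  colValid (sameLen-trace T′ e) (λ {r} {s} {z} → ok {z = z}) ∷ V
  where
  V = valid I′ T′ (λ m m′ q → let e₁ , e₂ = R (there m) (there m′) q in e₁ , suc-injective e₂)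
                  (MarkedCrossAbove-tail I T M)
  U = Unique-trace I′ T′
  ok : ∀ {r s z b} → Meet a C (trace as Cs) r s z b → OK z s b
  ok {z = bump} m = bump
  ok {s = s} {z = cross} {b = b} m with <-cmp s b
  ... | tri< i _ _ = cross i
  ... | tri> _ _ i with inverted⇒crossing I T′ m i
  ...   | _ , _ , m′ , _ with () ← proj₂ (R (here m) (there m′) (inj₂ (refl , refl)))
  ok {s = s} {z = cross} {b = b} m | tri≈ _ refl _ with Meet-top m
  ... | inj₁ refl = ⊥-elim (Inc-∉ I (∈-trace T′ (At⇒∈ (Meet-right m))))
  ... | inj₂ (_ , p , i) = ⊥-elim (<-irrefl (At-unique U p (Meet-right m)) i)
  ok {z = mbump} m with M (here m)
  ... | _ , _ , _ , _ , here m′ , i , inj₁ (refl , refl) =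
    ⊥-elim (<-irrefl (At-unique U (Meet-right m′) (Meet-right m)) i)
  ... | _ , _ , _ , _ , there m′ , i , inj₁ (refl , refl) =
    ⊥-elim (no-meeting-in-order I T′ V m m′)
  ... | _ , _ , _ , _ , there m′ , i , inj₂ (refl , refl) =
    mbump (cross-< (PipeMeet-OK V m′))
  -- Here `b` would be the pointer in a row above the one where it enters from the right.
  ... | _ , _ , _ , _ , here m′ , i , inj₂ (refl , refl) with Meet-top m′
  ...   | inj₁ refl = ⊥-elim (Inc-∉ I (∈-trace T′ (At⇒∈ (Meet-right m))))
  ...   | inj₂ (_ , p , i′) = ⊥-elim (<-irrefl (At-unique U p (Meet-right m)) (<-trans i′ i))

-- Removability in terms of the cells that a pipe visits.

bumpAbove : Bool → List Tile → ℕ → Bool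
bumpAbove p C zero = p
-- Past its listed tiles a column continues with the antidiagonal bump.
bumpAbove p [] (suc r) = true
bumpAbove p (z ∷ C) (suc r) = bumpAbove (isBump z) C r

bumpAbove′ : Cols → ℕ → ℕ → Bool
bumpAbove′ [] k r = false
bumpAbove′ (C ∷ Cs) zero r = bumpAbove false C r
bumpAbove′ (C ∷ Cs) (suc k) r = bumpAbove′ Cs k r

-- Conditions (ii) and (iii) of removability within one column.
Passable : ℕ → Bool → ℕ → List Tile → List ℕ → Set
Passable j p a C u = ∀ {r s z b} → Meet a C u r s z b → s ≡ j ⊎ b ≡ j →
  (z ≡ cross → bumpAbove p C r ≡ false) × z ≢ mbump

Passable-tail : Passable j p a (z ∷ C) (h ∷ u) → Passable j (isBump z) (next z a h) C u
Passable-tail L m q = L (there m) q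

-- If the pipe does not cross where it enters, it turns down at a bump. Condition (ii) forbids a
-- crossing right below that bump and (iii) forbids a mark, so a second unmarked bump follows.
Passable⇒ColIns : Passable j p a C u → SameLen C u → Unique (a ∷ u) → a ≢ j → At u r j →
                  ∃[ r′ ] ∃[ D ] ColIns p r r′ D C
Passable⇒ColIns L (cross ∷ l) U ne here with refl ← proj₁ (L here (inj₂ refl)) refl =
  _ , _ , crossing
Passable⇒ColIns L (mbump ∷ l) U ne here = ⊥-elim (proj₂ (L here (inj₂ refl)) refl)
Passable⇒ColIns L (bump ∷ []) U ne here = _ , _ , last
Passable⇒ColIns L (bump ∷ cross ∷ l) U ne here
  with () ← proj₁ (L (there here) (inj₁ refl)) refl
Passable⇒ColIns L (bump ∷ bump ∷ l) U ne here = _ , _ , double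
Passable⇒ColIns L (bump ∷ mbump ∷ l) U ne here = ⊥-elim (proj₂ (L (there here) (inj₁ refl)) refl)
Passable⇒ColIns {j = j} L (_∷_ z l) U@(_ ∷ d ∷ _) ne (there q) =
  let _ , _ , c = Passable⇒ColIns (Passable-tail L) l (Unique-next {z = z} U) (ne′ z) q
  in _ , _ , skip c
  where
  ne′ : ∀ z → next z _ _ ≢ j
  ne′ cross = ne
  ne′ bump refl = ∉-All d (At⇒∈ q)
  ne′ mbump refl = ∉-All d (At⇒∈ q)

Meet-≢ : j ∉ a ∷ u → Meet a C u r s z b → ¬ (s ≡ j ⊎ b ≡ j)
Meet-≢ j∉ m (inj₁ refl) = j∉ (Meet-top∈ m)
Meet-≢ j∉ m (inj₂ refl) = j∉ (there (At⇒∈ (Meet-right m)))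

ColIns⇒Passable : ColIns p r r′ D C → At u r j → Unique (a ∷ u) → a ≢ j → Passable j p a C u
ColIns⇒Passable crossing here U ne here q = (λ _ → refl) , λ ()
ColIns⇒Passable crossing here (d ∷ d′ ∷ _) ne (there m) q =
  ⊥-elim (Meet-≢ (λ { (here e) → ne (sym e) ; (there m) → ∉-All d′ m }) m q)
ColIns⇒Passable last here U ne here q = (λ ()) , λ ()
ColIns⇒Passable last here U ne (there ()) q
ColIns⇒Passable double here U ne here q = (λ ()) , λ ()
ColIns⇒Passable double here U ne (there here) q = (λ ()) , λ ()
ColIns⇒Passable double here (_ ∷ d ∷ _) ne (there (there m)) q = ⊥-elim (Meet-≢ (∉-All d) m q)
ColIns⇒Passable (skip c) (there p) U ne here (inj₁ e) = ⊥-elim (ne e)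
ColIns⇒Passable (skip c) (there p) (_ ∷ d ∷ _) ne here (inj₂ refl) = ⊥-elim (∉-All d (At⇒∈ p))
ColIns⇒Passable {j = j} (skip {z = z} c) (there p) U@(_ ∷ d ∷ _) ne (there m) q =
  ColIns⇒Passable c p (Unique-next {z = z} U) (ne′ z) m q
  where
  ne′ : ∀ z → next z _ _ ≢ j
  ne′ cross = ne
  ne′ bump refl = ∉-All d (At⇒∈ p)
  ne′ mbump refl = ∉-All d (At⇒∈ p)

Hook⇒Passable : Hook t C → Passable j false a C u
Hook⇒Passable (bumps bs) m q = go bs m
  where
  go : All (_≡ bump) C → Meet a C u r s z b → (z ≡ cross → bumpAbove p C r ≡ false) × z ≢ mbump
  go (refl ∷ bs) here = (λ ()) , λ ()
  go (refl ∷ bs) (there m) = go bs m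
Hook⇒Passable (cross g) here q = (λ _ → refl) , λ ()
Hook⇒Passable (cross g) (there m) q = Hook⇒Passable g m q

data HookAt (j : ℕ) : List ℕ → Cols → Set where
  here  : Hook r C → HookAt j (j ∷ as) (C ∷ Cs)
  there : a ≢ j → HookAt j as Cs → HookAt j (a ∷ as) (C ∷ Cs)

AllPassable : ℕ → List ℕ → Cols → Set
AllPassable j as Cs = ∀ {k r s z b} → PipeMeet k as Cs r s z b → s ≡ j ⊎ b ≡ j →
  (z ≡ cross → bumpAbove′ Cs k r ≡ false) × z ≢ mbump

-- The hook fixes the row in which `j` leaves its entry column. From there each column to the left
-- is passable and hands on the next row.
rem⁺ : Inc as → Tri as Cs → HookAt j as Cs → AllPassable j as Cs → Rem j as Cs
rem⁺ I T (here g) L = _ , _ , _ , enter g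
rem⁺ I@(_ ∷ I′) (e ∷ T) (there ne H) L with rem⁺ I′ T H (λ m → L (there m))
... | _ , _ , _ , P =
  let _ , _ , c = Passable⇒ColIns (λ m → L (here m)) (sameLen-trace T e)
                    (Unique-head I T (Unique-trace I′ T)) ne (Ins⇒At (PipeIns-trace P T))
  in _ , _ , _ , pass ne P c

rem⇒HookAt : PipeIns j r as Cs as′ Cs′ → HookAt j as′ Cs′
rem⇒HookAt (enter g) = here g
rem⇒HookAt (pass ne P c) = there ne (rem⇒HookAt P)

rem⇒AllPassable : Inc as′ → Tri as′ Cs′ → PipeIns j r as Cs as′ Cs′ → AllPassable j as′ Cs′
rem⇒AllPassable I (e ∷ T) (enter g) (here m) q = Hook⇒Passable g m q
rem⇒AllPassable I (e ∷ T) (enter g) (there m) (inj₁ refl) =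
  ⊥-elim (Inc-∉ I (PipeMeet-∈ T m (inj₁ refl)))
rem⇒AllPassable I (e ∷ T) (enter g) (there m) (inj₂ refl) =
  ⊥-elim (Inc-∉ I (PipeMeet-∈ T m (inj₂ refl)))
rem⇒AllPassable I@(_ ∷ I′) (e ∷ T) (pass ne P c) (here m) q =
  ColIns⇒Passable c (Ins⇒At (PipeIns-trace P T)) (Unique-head I T (Unique-trace I′ T)) ne m q
rem⇒AllPassable (_ ∷ I) (e ∷ T) (pass ne P c) (there m) q = rem⇒AllPassable I T P m q

-- Pipe dreams as sequences of columns

true≢false : true ≢ false
true≢false ()

addCol : List Tile → PipeDream → PipeDream
addCol [] R = (bump ∷ []) ∷ []
addCol (z ∷ C) [] = []
addCol (z ∷ C) (ρ ∷ R) = (z ∷ ρ) ∷ addCol C R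

-- The antidiagonal, which consists of unmarked bumps, is not part of Cols.
fromCols : Cols → PipeDream
fromCols [] = []
fromCols (C ∷ Cs) = addCol C (fromCols Cs)

length-addCol : ∀ {R} → SameLen C R → length (addCol C R) ≡ suc (length C)
length-addCol [] = refl
length-addCol (_ ∷ l) = cong suc (length-addCol l)

length-fromCols : Tri as Cs → length (fromCols Cs) ≡ length as
sameLen-fromCols : Tri as Cs → length C ≡ length as → SameLen C (fromCols Cs)
length-fromCols [] = refl
length-fromCols (_∷_ {C = C} e T) =
  trans (length-addCol (sameLen-fromCols {C = C} T e)) (cong suc e)
sameLen-fromCols T e = sameLen (trans e (sym (length-fromCols T)))

addCol-injective : ∀ {R S} → SameLen C R → SameLen D S → addCol C R ≡ addCol D S → C ≡ D × R ≡ S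
addCol-injective [] [] e = refl , refl
addCol-injective [] (_ ∷ []) ()
addCol-injective [] (_ ∷ _ ∷ l) ()
addCol-injective (_ ∷ []) [] ()
addCol-injective (_ ∷ _ ∷ l) [] ()
addCol-injective (_ ∷ l) (_ ∷ l′) e with ∷-injective e
... | refl , e′ with addCol-injective l l′ e′
... | refl , refl = refl , refl

fromCols-injective : Tri as Cs → Tri as Ds → fromCols Cs ≡ fromCols Ds → Cs ≡ Ds
fromCols-injective [] [] e = refl
fromCols-injective (e ∷ T) (e′ ∷ T′) q
  with addCol-injective (sameLen-fromCols T e) (sameLen-fromCols T′ e′) q
... | refl , q′ = cong (_ ∷_) (fromCols-injective T T′ q′)

-- Tracing by rows agrees with tracing by columns.

Labels : Set
Labels = List (Maybe ℕ)

-- A version of `traceRows` with a variable number for the first column, so that a column can be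
-- split off.
traceFrom : ℕ → ℕ → Labels → PipeDream → Labels × List Cell
traceFrom i k ts [] = [] , []
traceFrom i k ts (ρ ∷ P) =
  let a = traceRow i k ρ ts
      b = traceFrom (suc i) k (proj₁ (proj₂ a)) P
  in (proj₁ a ∷ proj₁ b) , (proj₂ (proj₂ a) ++ proj₂ b)

traceRows≡traceFrom : ∀ i ts P → traceRows i ts P ≡ traceFrom i 1 ts P
traceRows≡traceFrom i ts [] = refl
traceRows≡traceFrom i ts (ρ ∷ P)
  rewrite traceRows≡traceFrom (suc i) (proj₁ (proj₂ (traceRow i 1 ρ ts))) P = refl

cellOut-just : ∀ z → cellOut z (just a) (just h) ≡ (just (out z a h) , just (next z a h))
cellOut-just cross = refl
cellOut-just bump = refl
cellOut-just mbump = refl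

-- The exchange of the two orders: tracing whole rows has the effect of tracing all columns but the
-- first and then letting the first act on the result.
traceFrom-left : ∀ {R} i k ts → SameLen C R → SameLen C u →
                 proj₁ (traceFrom i (suc k) ts R) ≡ map just u →
                 proj₁ (traceFrom i k (just a ∷ ts) (addCol C R)) ≡ map just (run a C u)
traceFrom-left i k ts [] [] e = refl
traceFrom-left {a = a} {R = ρ ∷ R} i k ts (z ∷ l) (_∷_ _ {h} l′) e with ∷-injective e
... | e₁ , e₂ rewrite e₁ | cellOut-just {a} {h} z =
  cong (_ ∷_) (traceFrom-left (suc i) k (proj₁ (proj₂ (traceRow i (suc k) ρ ts))) l l′ e₂)

colCells : ℕ → ℕ → ℕ → List Tile → List ℕ → List Cell
colCells i k a (z ∷ C) (h ∷ u) =
  mkCell i k z (just a) (just h) ∷ colCells (suc i) k (next z a h) C u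
-- The antidiagonal cell, which no pipe enters from the right.
colCells i k a _ _ = mkCell i k bump (just a) nothing ∷ []

columnCells-hit : ∀ c cs → col c ≡ k → columnCells k (c ∷ cs) ≡ c ∷ columnCells k cs
columnCells-hit {k} c cs e rewrite dec-true (col c ≟ k) e = refl

columnCells-miss : ∀ c cs → col c ≢ k → columnCells k (c ∷ cs) ≡ columnCells k cs
columnCells-miss {k} c cs e rewrite dec-false (col c ≟ k) e = refl

columnCells-++ : ∀ k cs ds → columnCells k (cs ++ ds) ≡ columnCells k cs ++ columnCells k ds
columnCells-++ k [] ds = refl
columnCells-++ k (c ∷ cs) ds with col c ≡ᵇ k
... | true = cong (c ∷_) (columnCells-++ k cs ds)
... | false = columnCells-++ k cs ds

columnCells-none : ∀ cs → All (λ c → col c ≢ k) cs → columnCells k cs ≡ []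
columnCells-none [] [] = refl
columnCells-none (c ∷ cs) (n ∷ ns) = trans (columnCells-miss c cs n) (columnCells-none cs ns)

columnCells-all : ∀ cs → All (λ c → col c ≡ k) cs → columnCells k cs ≡ cs
columnCells-all [] [] = refl
columnCells-all (c ∷ cs) (n ∷ ns) = trans (columnCells-hit c cs n) (cong (c ∷_) (columnCells-all cs ns))

traceRow-cols : ∀ i k ρ ts → All (λ c → k ≤ col c) (proj₂ (proj₂ (traceRow i k ρ ts)))
traceRow-cols i k [] ts = []
traceRow-cols i k (z ∷ ρ) [] = []
traceRow-cols i k (z ∷ ρ) (t ∷ ts) = ≤-refl ∷ All.map <⇒≤ (traceRow-cols i (suc k) ρ ts)

colCells-cols : ∀ i k a C u → All (λ c → col c ≡ k) (colCells i k a C u)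
colCells-cols i k a [] u = refl ∷ []
colCells-cols i k a (z ∷ C) [] = refl ∷ []
colCells-cols i k a (z ∷ C) (h ∷ u) = refl ∷ colCells-cols (suc i) k (next z a h) C u

columnCells-right : ∀ i k ρ ts → columnCells k (proj₂ (proj₂ (traceRow i (suc k) ρ ts))) ≡ []
columnCells-right i k ρ ts =
  columnCells-none _ (All.map (λ l e → <-irrefl (sym e) l) (traceRow-cols i (suc k) ρ ts))

traceFrom-column : ∀ {R} i k ts → SameLen C R → SameLen C u →
                   proj₁ (traceFrom i (suc k) ts R) ≡ map just u →
                   columnCells k (proj₂ (traceFrom i k (just a ∷ ts) (addCol C R))) ≡
                   colCells i k a C u
traceFrom-column i k ts [] [] e = columnCells-hit _ [] refl
traceFrom-column {C = _ ∷ C} {a = a} {R = ρ ∷ R} i k ts (z ∷ l) (_∷_ _ {h} l′) e with ∷-injective e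
... | e₁ , e₂ rewrite e₁ | cellOut-just {a} {h} z =
  trans (columnCells-hit _ (X ++ Y) refl)
    (cong (_ ∷_) (trans (columnCells-++ k X Y)
      (trans (cong (_++ columnCells k Y) (columnCells-right i k ρ ts))
        (traceFrom-column (suc i) k (proj₁ (proj₂ (traceRow i (suc k) ρ ts))) l l′ e₂))))
  where
  X = proj₂ (proj₂ (traceRow i (suc k) ρ ts))
  Y = proj₂ (traceFrom (suc i) k (just (next z a h) ∷ proj₁ (proj₂ (traceRow i (suc k) ρ ts)))
                       (addCol C R))

traceFrom-column′ : ∀ {R} i k n t ts → SameLen C R → n ≢ k →
                    columnCells n (proj₂ (traceFrom i k (t ∷ ts) (addCol C R))) ≡
                    columnCells n (proj₂ (traceFrom i (suc k) ts R))
traceFrom-column′ i k n t ts [] n≢k = columnCells-miss _ [] (n≢k ∘ sym)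
traceFrom-column′ {C = _ ∷ C} {R = ρ ∷ R} i k n t ts (z ∷ l) n≢k =
  trans (columnCells-miss _ (X ++ Y) (n≢k ∘ sym))
    (trans (columnCells-++ n X Y)
      (trans (cong (columnCells n X ++_) (traceFrom-column′ (suc i) k n _ _ l n≢k))
        (sym (columnCells-++ n X _))))
  where
  X = proj₂ (proj₂ (traceRow i (suc k) ρ ts))
  Y = proj₂ (traceFrom (suc i) k
        (proj₂ (cellOut z t (proj₁ (traceRow i (suc k) ρ ts))) ∷ proj₁ (proj₂ (traceRow i (suc k) ρ ts)))
        (addCol C R))

-- The same cells as `cellsOf`, which lists them by rows. The two lists are compared one column at a
-- time, where their orders agree.
cellsByColumn : ℕ → List ℕ → Cols → List Cell
cellsByColumn k (a ∷ as) (C ∷ Cs) = colCells 1 k a C (trace as Cs) ++ cellsByColumn (suc k) as Cs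
cellsByColumn k _ _ = []

cellsByColumn-cols : ∀ k as Cs → All (λ c → k ≤ col c) (cellsByColumn k as Cs)
cellsByColumn-cols k [] Cs = []
cellsByColumn-cols k (a ∷ as) [] = []
cellsByColumn-cols k (a ∷ as) (C ∷ Cs) =
  ++⁺ (All.map (λ e → ≤-reflexive (sym e)) (colCells-cols 1 k a C (trace as Cs)))
      (All.map <⇒≤ (cellsByColumn-cols (suc k) as Cs))

columnCells-first : ∀ k a C u as Cs →
  columnCells k (colCells 1 k a C u ++ cellsByColumn (suc k) as Cs) ≡ colCells 1 k a C u
columnCells-first k a C u as Cs =
  trans (columnCells-++ k (colCells 1 k a C u) _)
    (trans (cong₂ _++_ (columnCells-all _ (colCells-cols 1 k a C u))
                       (columnCells-none _ (All.map (λ l e → <-irrefl (sym e) l)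
                                              (cellsByColumn-cols (suc k) as Cs))))
           (++-identityʳ _))

columnCells-rest : ∀ k n a C u as Cs → n ≢ k →
  columnCells n (colCells 1 k a C u ++ cellsByColumn (suc k) as Cs) ≡
  columnCells n (cellsByColumn (suc k) as Cs)
columnCells-rest k n a C u as Cs n≢k =
  trans (columnCells-++ n (colCells 1 k a C u) _)
    (cong (_++ columnCells n (cellsByColumn (suc k) as Cs))
      (columnCells-none _ (All.map (λ e e′ → n≢k (trans (sym e′) e)) (colCells-cols 1 k a C u))))

traceFrom-trace : ∀ k → Tri as Cs →
                  proj₁ (traceFrom 1 k (map just as) (fromCols Cs)) ≡ map just (trace as Cs)
traceFrom-trace k [] = refl
traceFrom-trace k (e ∷ T) =
  traceFrom-left 1 k _ (sameLen-fromCols T e) (sameLen-trace T e) (traceFrom-trace (suc k) T)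

traceFrom-columns : ∀ k n → Tri as Cs →
                    columnCells n (proj₂ (traceFrom 1 k (map just as) (fromCols Cs))) ≡
                    columnCells n (cellsByColumn k as Cs)
traceFrom-columns k n [] = refl
traceFrom-columns {as = a ∷ as} {Cs = C ∷ Cs} k n (e ∷ T) with n ≟ k
... | yes refl =
  trans (traceFrom-column 1 k _ (sameLen-fromCols T e) (sameLen-trace T e) (traceFrom-trace (suc k) T))
        (sym (columnCells-first k a C (trace as Cs) as Cs))
... | no n≢k =
  trans (traceFrom-column′ 1 k n (just a) _ (sameLen-fromCols {C = C} T e) n≢k)
    (trans (traceFrom-columns (suc k) n T) (sym (columnCells-rest k n a C (trace as Cs) as Cs n≢k)))

∈-columnCells⁺ : ∀ {c cs} → c ∈ cs → c ∈ columnCells (col c) cs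
∈-columnCells⁺ {c} {c ∷ cs} (here refl) = subst (c ∈_) (sym (columnCells-hit c cs refl)) (here refl)
∈-columnCells⁺ {c} {d ∷ cs} (there m) with col d ≡ᵇ col c
... | true = there (∈-columnCells⁺ m)
... | false = ∈-columnCells⁺ m

∈-columnCells⁻ : ∀ {c} cs → c ∈ columnCells k cs → c ∈ cs
∈-columnCells⁻ {k} (d ∷ cs) m with col d ≡ᵇ k
∈-columnCells⁻ (d ∷ cs) (here e) | true = here e
∈-columnCells⁻ (d ∷ cs) (there m) | true = there (∈-columnCells⁻ cs m)
... | false = there (∈-columnCells⁻ cs m)

cellsOf-columns : ∀ v n → Tri (sort v) Cs →
                  columnCells n (cellsOf v (fromCols Cs)) ≡ columnCells n (cellsByColumn 1 (sort v) Cs)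
cellsOf-columns {Cs} v n T =
  trans (cong (columnCells n ∘ proj₂) (traceRows≡traceFrom 1 (topLabels v) (fromCols Cs)))
        (traceFrom-columns 1 n T)

leftLabels-trace : ∀ v → Tri (sort v) Cs → leftLabels v (fromCols Cs) ≡ map just (trace (sort v) Cs)
leftLabels-trace {Cs} v T =
  trans (cong proj₁ (traceRows≡traceFrom 1 (topLabels v) (fromCols Cs))) (traceFrom-trace 1 T)

row-∈ : ∀ {t t′ cs} → m ≡ n → mkCell m k z t t′ ∈ cs → mkCell n k z t t′ ∈ cs
row-∈ refl c∈ = c∈

col-∈ : ∀ {t t′ cs} → m ≡ n → mkCell i m z t t′ ∈ cs → mkCell i n z t t′ ∈ cs
col-∈ refl c∈ = c∈

-- The translation between numberings: `PipeMeet` counts from 0, cells count rows from 1 and columns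
-- from `k`.
data View (k : ℕ) (as : List ℕ) (Cs : Cols) : Cell → Set where
  diagonal : ∀ {i t} → View k as Cs (mkCell i n bump t nothing)
  meeting  : PipeMeet m as Cs r s z b → n ≡ k + m →
             View k as Cs (mkCell (suc r) n z (just s) (just b))

colCells-view : ∀ {c} i k → SameLen C u → c ∈ colCells i k a C u →
  (∃[ n ] ∃[ t ] c ≡ mkCell n k bump t nothing) ⊎
  (∃[ r ] ∃[ s ] ∃[ z ] ∃[ b ] (Meet a C u r s z b × c ≡ mkCell (i + r) k z (just s) (just b)))
colCells-view i k [] (here refl) = inj₁ (_ , _ , refl)
colCells-view i k (z ∷ l) (here refl) =
  inj₂ (_ , _ , _ , _ , here , cong (λ n → mkCell n k z (just _) (just _)) (sym (+-identityʳ i)))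
colCells-view i k (z ∷ l) (there c∈) with colCells-view (suc i) k l c∈
... | inj₁ d = inj₁ d
... | inj₂ (r , s , z′ , b , m , refl) =
  inj₂ (_ , _ , _ , _ , there m , cong (λ n → mkCell n k z′ (just s) (just b)) (sym (+-suc i r)))

Meet⇒∈ : ∀ i k → Meet a C u r s z b → mkCell (i + r) k z (just s) (just b) ∈ colCells i k a C u
Meet⇒∈ i k here = row-∈ (sym (+-identityʳ i)) (here refl)
Meet⇒∈ {r = suc r} i k (there m) =
  there (row-∈ (sym (+-suc i r)) (Meet⇒∈ (suc i) k m))

view : ∀ {c} k → Tri as Cs → c ∈ cellsByColumn k as Cs → View k as Cs c
view {as = a ∷ as} {Cs = C ∷ Cs} k (e ∷ T) c∈ with ∈-++⁻ (colCells 1 k a C (trace as Cs)) c∈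
... | inj₁ m with colCells-view 1 k (sameLen-trace T e) m
...   | inj₁ (_ , _ , refl) = diagonal
...   | inj₂ (_ , _ , _ , _ , m′ , refl) = meeting (here m′) (sym (+-identityʳ k))
view k (e ∷ T) c∈ | inj₂ m with view (suc k) T m
...   | diagonal = diagonal
...   | meeting {m = n} m′ refl = meeting (there m′) (sym (+-suc k n))

PipeMeet⇒∈ : ∀ k → PipeMeet m as Cs r s z b →
             mkCell (suc r) (k + m) z (just s) (just b) ∈ cellsByColumn k as Cs
PipeMeet⇒∈ k (here m) =
  ∈-++⁺ˡ (col-∈ (sym (+-identityʳ k)) (Meet⇒∈ 1 k m))
PipeMeet⇒∈ {suc n} {a ∷ as} {C ∷ Cs} k (there m) =
  ∈-++⁺ʳ (colCells 1 k a C (trace as Cs))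
    (col-∈ (sym (+-suc k n)) (PipeMeet⇒∈ (suc k) m))

cellsOf-view : ∀ {c} v → Tri (sort v) Cs → c ∈ cellsOf v (fromCols Cs) → View 1 (sort v) Cs c
cellsOf-view {Cs} {c} v T c∈ =
  view 1 T (∈-columnCells⁻ _ (subst (c ∈_) (cellsOf-columns v (col c) T) (∈-columnCells⁺ c∈)))

cell∈ : ∀ v → Tri (sort v) Cs → PipeMeet m (sort v) Cs r s z b →
        mkCell (suc r) (suc m) z (just s) (just b) ∈ cellsOf v (fromCols Cs)
cell∈ {m = m} v T pm =
  ∈-columnCells⁻ _ (subst (_ ∈_) (sym (cellsOf-columns v (suc m) T)) (∈-columnCells⁺ (PipeMeet⇒∈ 1 pm)))

Meet-row< : Meet a C u r s z b → r < length C
Meet-row< here = s≤s z≤n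
Meet-row< (there m) = s≤s (Meet-row< m)

PipeMeet-row< : Tri as Cs → PipeMeet m as Cs r s z b → suc (r + m) < length as
PipeMeet-row< {r = r} (e ∷ T) (here m) =
  s≤s (subst₂ _<_ (sym (+-identityʳ r)) e (Meet-row< m))
PipeMeet-row< {m = suc m} {r = r} (e ∷ T) (there pm) =
  s≤s (≤-trans (≤-reflexive (cong suc (+-suc r m))) (PipeMeet-row< T pm))

-- Splitting a staircase into columns.

Shape-addCol : ∀ {R} → SameLen C R → Shape (length C) R → Shape (suc (length C)) (addCol C R)
Shape-addCol [] S = refl
Shape-addCol (z ∷ l) S with ∷-injective S
... | e , S′ = cong₂ _∷_ (cong suc e) (Shape-addCol l S′)

Shape-fromCols : Tri as Cs → Shape (length as) (fromCols Cs)
Shape-fromCols [] = refl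
Shape-fromCols {as = a ∷ as} {Cs = C ∷ Cs} (e ∷ T) =
  subst (λ n → Shape (suc n) (addCol C (fromCols Cs))) e
    (Shape-addCol (sameLen-fromCols T e) (subst (λ n → Shape n (fromCols Cs)) (sym e) (Shape-fromCols T)))

data EndsInBump : List Tile → Set where
  end  : EndsInBump (bump ∷ [])
  cons : ∀ {ρ} → EndsInBump ρ → EndsInBump (z ∷ ρ)

splitCol : ∀ n P → Shape (suc n) P → All EndsInBump P →
           ∃[ C ] ∃[ R ] (P ≡ addCol C R × length C ≡ n × Shape n R × All EndsInBump R)
splitCol zero ((bump ∷ []) ∷ []) S (end ∷ []) = [] , [] , refl , refl , refl , []
splitCol zero ((z ∷ []) ∷ []) S (cons () ∷ _)
splitCol (suc n) ((z ∷ []) ∷ P) () b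
splitCol (suc n) ((z ∷ ρ@(_ ∷ _)) ∷ P) S (cons b ∷ bs) with ∷-injective S
... | e , S′ =
  let C , R , e₁ , e₂ , S″ , bs′ = splitCol n P S′ bs
  in z ∷ C , ρ ∷ R , cong (_ ∷_) e₁ , cong suc e₂ , cong₂ _∷_ (suc-injective e) S″ , b ∷ bs′

toCols : ∀ as P → Shape (length as) P → All EndsInBump P → ∃[ Cs ] (P ≡ fromCols Cs × Tri as Cs)
toCols [] [] S b = [] , refl , []
toCols (a ∷ as) P S b =
  let C , R , e₁ , e₂ , S′ , b′ = splitCol (length as) P S b
      Cs , e₃ , T = toCols as R S′ b′
  in C ∷ Cs , trans e₁ (cong (addCol C) e₃) , e₂ ∷ T

lastCell : ∀ i k ρ ts n → length ρ ≡ suc n → n < length ts →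
           ∃[ z ] ∃[ t ] (mkCell i (k + n) z t nothing ∈ proj₂ (proj₂ (traceRow i k ρ ts)) ×
                          (z ≡ bump → EndsInBump ρ))
lastCell i k (z ∷ []) (t ∷ ts) zero e l =
  z , t , here (cong (λ n → mkCell i n z t nothing) (+-identityʳ k)) , λ { refl → end }
lastCell i k (z ∷ ρ@(_ ∷ _)) (t ∷ ts) (suc n) e (s≤s l) =
  let z′ , t′ , c∈ , f = lastCell i (suc k) ρ ts n (suc-injective e) l
  in z′ , t′ , there (col-∈ (sym (+-suc k n)) c∈) , cons ∘ f

length-traceRow : ∀ i k ρ ts → length ρ ≤ length ts → length (proj₁ (proj₂ (traceRow i k ρ ts))) ≡ length ρ
length-traceRow i k [] ts l = refl
length-traceRow i k (z ∷ ρ) (t ∷ ts) (s≤s l) = cong suc (length-traceRow i (suc k) ρ ts l)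

-- The last cell of each row is traced with nothing on its right and lies on the antidiagonal, so
-- the assumption on such cells applies to it.
endsInBump : ∀ i m P ts → Shape m P → m ≤ length ts →
             (∀ c → c ∈ proj₂ (traceRows i ts P) → right c ≡ nothing → row c + col c ≡ i + m →
              tile c ≡ bump) → All EndsInBump P
endsInBump i zero [] ts S l f = []
endsInBump i (suc m) (ρ ∷ P) ts S l f with ∷-injective S
... | e , S′ =
  let z , t , c∈ , g = lastCell i 1 ρ ts m e l
  in g (f _ (∈-++⁺ˡ c∈) refl refl) ∷
     endsInBump (suc i) m P (proj₁ (proj₂ (traceRow i 1 ρ ts))) S′
       (≤-trans (n≤1+n m) (≤-reflexive (sym (trans (length-traceRow i 1 ρ ts
         (≤-trans (≤-reflexive e) l)) e))))
       (λ c c∈ e₁ e₂ → f c (∈-++⁺ʳ _ c∈) e₁ (trans e₂ (sym (+-suc i m))))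

-- Marked reduced pipe dreams in terms of columns

≤ᵇ-reflects : (x ≤ᵇ y) ≡ true → x ≤ y
≤ᵇ-reflects {x} {y} e = ≤ᵇ⇒≤ x y (subst T (sym e) tt)

∧-true⁻ : ∀ {p q} → p ∧ q ≡ true → p ≡ true × q ≡ true
∧-true⁻ {true} {true} e = refl , refl

-- Sorting and deleting letters of a word.

insert-∈⁻ : ∀ v → y ∈ insert x v → y ∈ x ∷ v
insert-∈⁻ [] m = m
insert-∈⁻ {x = x} (k ∷ v) m with x ≤ᵇ k
... | true = m
insert-∈⁻ (k ∷ v) (here e) | false = there (here e)
insert-∈⁻ (k ∷ v) (there m) | false with insert-∈⁻ v m
... | here e = here e
... | there m′ = there (there m′)

insert-∈⁺ : ∀ v → y ∈ x ∷ v → y ∈ insert x v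
insert-∈⁺ [] m = m
insert-∈⁺ {x = x} (k ∷ v) m with x ≤ᵇ k
... | true = m
insert-∈⁺ (k ∷ v) (here e) | false = there (insert-∈⁺ v (here e))
insert-∈⁺ (k ∷ v) (there (here e)) | false = here e
insert-∈⁺ (k ∷ v) (there (there m)) | false = there (insert-∈⁺ v (there m))

length-insert : ∀ x v → length (insert x v) ≡ suc (length v)
length-insert x [] = refl
length-insert x (k ∷ v) with x ≤ᵇ k
... | true = refl
... | false = cong suc (length-insert x v)

Inc-insert : x ∉ v → Inc v → Inc (insert x v)
Inc-insert x∉ [] = [] ∷ []
Inc-insert {x} {k ∷ v} x∉ (l ∷ I) with x ≤ᵇ k in e
... | true = (x<k ∷ All.map (<-trans x<k) l) ∷ l ∷ I
  where x<k = ≤∧≢⇒< (≤ᵇ-reflects e) (λ e′ → x∉ (here e′))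
... | false = All.tabulate (λ m → bound (insert-∈⁻ v m)) ∷ Inc-insert (x∉ ∘ there) I
  where
  bound : y ∈ x ∷ v → k < y
  bound (here refl) = ≰⇒> (λ x≤k → true≢false (trans (sym (dec-true (x ≤? k) x≤k)) e))
  bound (there m) = All.lookup l m

sort-∈⁻ : ∀ v → x ∈ sort v → x ∈ v
sort-∈⁻ (k ∷ v) m with insert-∈⁻ (sort v) m
... | here e = here e
... | there m′ = there (sort-∈⁻ v m′)

sort-∈⁺ : ∀ v → x ∈ v → x ∈ sort v
sort-∈⁺ (k ∷ v) (here e) = insert-∈⁺ (sort v) (here e)
sort-∈⁺ (k ∷ v) (there m) = insert-∈⁺ (sort v) (there (sort-∈⁺ v m))

length-sort : ∀ v → length (sort v) ≡ length v
length-sort [] = refl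
length-sort (x ∷ v) = trans (length-insert x (sort v)) (cong suc (length-sort v))

Inc-sort : Unique v → Inc (sort v)
Inc-sort [] = []
Inc-sort {x ∷ v} (d ∷ U) = Inc-insert (∉-All d ∘ sort-∈⁻ v) (Inc-sort U)

delete-hit : ∀ j v → deleteLbl j (j ∷ v) ≡ deleteLbl j v
delete-hit j v rewrite dec-true (j ≟ j) refl = refl

delete-miss : ∀ v → x ≢ j → deleteLbl j (x ∷ v) ≡ x ∷ deleteLbl j v
delete-miss {x} {j} v n rewrite dec-false (x ≟ j) n = refl

delete-∉ : ∀ v → j ∉ v → deleteLbl j v ≡ v
delete-∉ [] n = refl
delete-∉ (x ∷ v) n =
  trans (delete-miss v (λ e → n (here (sym e)))) (cong (x ∷_) (delete-∉ v (n ∘ there)))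

delete-Ins : Ins n j u v → j ∉ u → deleteLbl j v ≡ u
delete-Ins {u = u} zero n = trans (delete-hit _ u) (delete-∉ u n)
delete-Ins (suc {xs = u} {ys = v} q) n =
  trans (delete-miss v (λ e → n (here (sym e)))) (cong (_ ∷_) (delete-Ins q (n ∘ there)))

Ins-delete : Unique v → j ∈ v → ∃[ n ] Ins n j (deleteLbl j v) v
Ins-delete {x ∷ v} (d ∷ U) (here refl) =
  0 , subst (λ u → Ins 0 x u (x ∷ v)) (sym (trans (delete-hit x v) (delete-∉ v (∉-All d)))) zero
Ins-delete {x ∷ v} {j} (d ∷ U) (there m) =
  let n , q = Ins-delete U m
  in suc n , subst (λ u → Ins (suc n) j u (x ∷ v)) (sym (delete-miss v (All.lookup d m))) (suc q)

filterᵇ-⊆ : ∀ (f : ℕ → Bool) v → filterᵇ f v ⊆ v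
filterᵇ-⊆ f [] = []
filterᵇ-⊆ f (x ∷ v) with f x
... | true = refl ∷ filterᵇ-⊆ f v
... | false = x ∷ʳ filterᵇ-⊆ f v

filterᵇ-∈⁻ : ∀ (f : ℕ → Bool) v → x ∈ filterᵇ f v → x ∈ v × f x ≡ true
filterᵇ-∈⁻ f (k ∷ v) m with f k in e
filterᵇ-∈⁻ f (k ∷ v) (here refl) | true = here refl , e
filterᵇ-∈⁻ f (k ∷ v) (there m) | true = let m′ , e′ = filterᵇ-∈⁻ f v m in there m′ , e′
... | false = let m′ , e′ = filterᵇ-∈⁻ f v m in there m′ , e′

filterᵇ-∈⁺ : ∀ (f : ℕ → Bool) v → x ∈ v → f x ≡ true → x ∈ filterᵇ f v
filterᵇ-∈⁺ f (k ∷ v) (here refl) e rewrite e = here refl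
filterᵇ-∈⁺ f (k ∷ v) (there m) e with f k
... | true = there (filterᵇ-∈⁺ f v m e)
... | false = filterᵇ-∈⁺ f v m e

filterᵇ-cong : ∀ (f g : ℕ → Bool) v → (∀ {x} → x ∈ v → f x ≡ g x) → filterᵇ f v ≡ filterᵇ g v
filterᵇ-cong f g [] e = refl
filterᵇ-cong f g (x ∷ v) e rewrite e {x} (here refl) with g x
... | true = cong (x ∷_) (filterᵇ-cong f g v (e ∘ there))
... | false = filterᵇ-cong f g v (e ∘ there)

delete-∈⁻ : ∀ j v → x ∈ deleteLbl j v → x ∈ v × x ≢ j
delete-∈⁻ {x} j v m with filterᵇ-∈⁻ _ v m
... | m′ , e = m′ , λ e′ → true≢false (trans (sym e) (cong not (dec-true (x ≟ j) e′)))

delete-∈⁺ : ∀ j v → x ∈ v → x ≢ j → x ∈ deleteLbl j v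
delete-∈⁺ {x} j v m n = filterᵇ-∈⁺ _ v m (cong not (dec-false (x ≟ j) n))

insert-min : All (x ≤_) v → insert x v ≡ x ∷ v
insert-min [] = refl
insert-min {x} {k ∷ v} (l ∷ _) rewrite dec-true (x ≤? k) l = refl

delete-insert-same : ∀ j v → deleteLbl j (insert j v) ≡ deleteLbl j v
delete-insert-same j [] = delete-hit j []
delete-insert-same j (k ∷ v) with j ≤ᵇ k
... | true = delete-hit j (k ∷ v)
... | false with k ≡ᵇ j
...   | true = delete-insert-same j v
...   | false = cong (k ∷_) (delete-insert-same j v)

delete-insert : Inc v → x ≢ j → deleteLbl j (insert x v) ≡ insert x (deleteLbl j v)
delete-insert [] n = delete-miss [] n
delete-insert {k ∷ v} {x} {j} (l ∷ I) n with x ≤ᵇ k in e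
... | true = trans (delete-miss (k ∷ v) n)
               (sym (insert-min (All.tabulate (λ m → bound (proj₁ (delete-∈⁻ j (k ∷ v) m))))))
  where
  bound : y ∈ k ∷ v → x ≤ y
  bound (here refl) = ≤ᵇ-reflects e
  bound (there m) = ≤-trans (≤ᵇ-reflects e) (<⇒≤ (All.lookup l m))
... | false with k ≡ᵇ j
...   | true = delete-insert I n
...   | false rewrite e = cong (k ∷_) (delete-insert I n)

-- Identifies the top labels that remain after pipe `j` is deleted with those of the shorter word.
delete-sort : ∀ j → Unique v → deleteLbl j (sort v) ≡ sort (deleteLbl j v)
delete-sort j [] = refl
delete-sort {x ∷ v} j (d ∷ U) with x ≟ j
... | yes refl = trans (delete-insert-same x (sort v))
                   (trans (delete-sort x U) (cong sort (sym (delete-hit x v))))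
... | no n = trans (delete-insert (Inc-sort U) n)
               (trans (cong (insert x) (delete-sort j U)) (cong sort (sym (delete-miss v n))))

-- The column form of `IsMRPD`: `Valid` stands for reducedness together with the condition on marks,
-- and the antidiagonal bumps are implicit.
record MRPD (v : List ℕ) (Cs : Cols) : Set where
  constructor mrpd
  field
    tri   : Tri (sort v) Cs
    okay  : Valid (sort v) Cs
    word  : trace (sort v) Cs ≡ v
open MRPD

IsMRPD⇒MRPD : ∀ P → Unique v → IsMRPD v P → ∃[ Cs ] (P ≡ fromCols Cs × MRPD v Cs)
IsMRPD⇒MRPD {v} P U (S , D , R , L , M)
  with toCols (sort v) P (subst (λ n → Shape n P) (sym (length-sort v)) S)
         (endsInBump 1 (length v) P (topLabels v) S
           (≤-reflexive (sym (trans (length-map just (sort v)) (length-sort v)))) diag)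
  where
  diag : ∀ c → c ∈ cellsOf v P → right c ≡ nothing → row c + col c ≡ suc (length v) → tile c ≡ bump
  diag c c∈ e e′ with tile c in q
  ... | bump = refl
  ... | cross = ⊥-elim (All.lookup D c∈ e′ q)
  -- A marked tile needs a label on its right, which an antidiagonal cell does not have.
  ... | mbump with All.lookup M c∈ q
  ...   | _ , _ , _ , e″ , _ with () ← trans (sym e) e″
... | Cs , refl , T = Cs , refl , mrpd T (valid (Inc-sort U) T once crossed)
                                    (map-injective just-injective (trans (sym (leftLabels-trace v T)) L))
  where
  once : CrossOnce (sort v) Cs
  once m m′ q with R _ _ (cell∈ v T m) (cell∈ v T m′) refl refl (same q)
    where
    same : ∀ {s b s′ b′ : ℕ} → SameLabels s b s′ b′ →
           (just s ≡ just s′ × just b ≡ just b′) ⊎ (just s ≡ just b′ × just b ≡ just s′)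
    same (inj₁ (refl , refl)) = inj₁ (refl , refl)
    same (inj₂ (refl , refl)) = inj₂ (refl , refl)
  ... | e , e′ = suc-injective e , suc-injective e′
  crossed : MarkedCrossAbove (sort v) Cs
  crossed m with All.lookup M (cell∈ v T m) refl
  ... | _ , _ , refl , refl , d , d∈ , e , l , q with cellsOf-view v T d∈
  crossed m | _ , _ , refl , refl , d , d∈ , () , l , q | diagonal
  crossed m | _ , _ , refl , refl , d , d∈ , refl , s≤s l , inj₁ (refl , refl) | meeting m′ e″ =
    _ , _ , _ , _ , m′ , l , inj₁ (refl , refl)
  crossed m | _ , _ , refl , refl , d , d∈ , refl , s≤s l , inj₂ (refl , refl) | meeting m′ e″ =
    _ , _ , _ , _ , m′ , l , inj₂ (refl , refl)

MRPD⇒IsMRPD : Unique v → MRPD v Cs → IsMRPD v (fromCols Cs)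
MRPD⇒IsMRPD {v} {Cs} U (mrpd T V W) =
  subst (λ n → Shape n (fromCols Cs)) (length-sort v) (Shape-fromCols T) ,
  All.tabulate diag , reduced , trans (leftLabels-trace v T) (cong (map just) W) ,
  All.tabulate marks
  where
  diag : ∀ {c} → c ∈ cellsOf v (fromCols Cs) → row c + col c ≡ suc (length v) → tile c ≢ cross
  diag c∈ e e′ with cellsOf-view v T c∈
  diag c∈ e () | diagonal
  diag c∈ e e′ | meeting {m = m} {r = r} pm refl =
    <-irrefl (suc-injective (trans (sym (cong suc (+-suc r m))) e))
             (≤-trans (PipeMeet-row< T pm) (≤-reflexive (length-sort v)))
  reduced : Reduced (cellsOf v (fromCols Cs))
  reduced c d c∈ d∈ e e′ q with cellsOf-view v T c∈ | cellsOf-view v T d∈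
  reduced c d c∈ d∈ () e′ q | diagonal | _
  reduced c d c∈ d∈ e () q | meeting _ _ | diagonal
  reduced c d c∈ d∈ refl refl (inj₁ (refl , refl)) | meeting m refl | meeting m′ refl =
    let e₁ , e₂ = Valid⇒CrossOnce (Inc-sort U) T V m m′ (inj₁ (refl , refl))
    in cong suc e₁ , cong suc e₂
  reduced c d c∈ d∈ refl refl (inj₂ (refl , refl)) | meeting m refl | meeting m′ refl =
    let e₁ , e₂ = Valid⇒CrossOnce (Inc-sort U) T V m m′ (inj₂ (refl , refl))
    in cong suc e₁ , cong suc e₂
  marks : ∀ {c} → c ∈ cellsOf v (fromCols Cs) → tile c ≡ mbump →
    Σ ℕ λ a → Σ ℕ λ b → top c ≡ just a × right c ≡ just b ×
      Σ Cell λ d → d ∈ cellsOf v (fromCols Cs) × tile d ≡ cross × row d < row c × SamePair c d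
  marks c∈ e with cellsOf-view v T c∈
  marks c∈ () | diagonal
  marks c∈ refl | meeting m refl with Valid⇒MarkedCrossAbove (Inc-sort U) T V m
  ... | _ , _ , _ , _ , m′ , l , inj₁ (refl , refl) =
    _ , _ , refl , refl , _ , cell∈ v T m′ , refl , s≤s l , inj₁ (refl , refl)
  ... | _ , _ , _ , _ , m′ , l , inj₂ (refl , refl) =
    _ , _ , refl , refl , _ , cell∈ v T m′ , refl , s≤s l , inj₂ (refl , refl)

-- Removable pipes and the map Φ_j

allᵇ⁻ : ∀ (f : Cell → Bool) cs → allᵇ f cs ≡ true → ∀ {c} → c ∈ cs → f c ≡ true
allᵇ⁻ f (d ∷ cs) e (here refl) = proj₁ (∧-true⁻ e)
allᵇ⁻ f (d ∷ cs) e (there m) = allᵇ⁻ f cs (proj₂ (∧-true⁻ {f d} e)) m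

allᵇ⁺ : ∀ (f : Cell → Bool) cs → (∀ {c} → c ∈ cs → f c ≡ true) → allᵇ f cs ≡ true
allᵇ⁺ f [] e = refl
allᵇ⁺ f (d ∷ cs) e rewrite e (here refl) = allᵇ⁺ f cs (e ∘ there)

colPhase2⇒bumps : ∀ i → SameLen C u → colPhase2 (colCells i k a C u) ≡ true → All (_≡ bump) C
colPhase2⇒bumps i [] e = []
colPhase2⇒bumps i (bump ∷ l) e = refl ∷ colPhase2⇒bumps (suc i) l e

bumps⇒colPhase2 : ∀ i → SameLen C u → All (_≡ bump) C → colPhase2 (colCells i k a C u) ≡ true
bumps⇒colPhase2 i [] b = refl
bumps⇒colPhase2 i (_ ∷ l) (refl ∷ b) = bumps⇒colPhase2 (suc i) l b

colPhase1⇒Hook : ∀ i → SameLen C u → colPhase1 j (colCells i k j C u) ≡ true → ∃[ r ] Hook r C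
colPhase1⇒Hook i [] e = _ , bumps []
colPhase1⇒Hook {j = j} i (cross ∷ l) e rewrite dec-true (j ≟ j) refl =
  let _ , g = colPhase1⇒Hook (suc i) l (∨-false⁻ e) in _ , cross g
  where
  ∨-false⁻ : ∀ {p} → p ∨ false ≡ true → p ≡ true
  ∨-false⁻ {true} e = refl
colPhase1⇒Hook i (bump ∷ l) e = _ , bumps (refl ∷ colPhase2⇒bumps (suc i) l e)

Hook⇒colPhase1 : ∀ i → SameLen C u → Hook r C → colPhase1 j (colCells i k j C u) ≡ true
Hook⇒colPhase1 i [] (bumps b) = refl
Hook⇒colPhase1 {j = j} {k = k} i (_ ∷ l) (cross g)
  rewrite dec-true (j ≟ j) refl | Hook⇒colPhase1 {j = j} {k = k} (suc i) l g = refl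
Hook⇒colPhase1 i (_ ∷ l) (bumps (refl ∷ b)) = bumps⇒colPhase2 (suc i) l b

posOf-suc : j ∈ as → ∃[ n ] posOf as j ≡ suc n
posOf-suc {j} {a ∷ as} m with a ≡ᵇ j
... | true = _ , refl
... | false = _ , refl

-- Connects condition (i), which finds the column of `j` by its number, with the inductive `HookAt`;
-- `k` is the number of columns already passed.
entryColumn : Inc as → Tri as Cs → j ∈ as → ∀ k →
  (∃[ n ] ∃[ C ] ∃[ u ] (SameLen C u × columnCells (k + posOf as j) (cellsByColumn (suc k) as Cs) ≡
                  colCells 1 n j C u ×
                  (∀ {r} → Hook r C → HookAt j as Cs) ×
                  (HookAt j as Cs → ∃[ r ] Hook r C)))
entryColumn {a ∷ as} {C ∷ Cs} {j} I (e ∷ T) j∈ k with a ≟ j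
... | yes refl rewrite dec-true (a ≟ a) refl | +-comm k 1 =
  suc k , C , trace as Cs , sameLen-trace T e , columnCells-first (suc k) a C (trace as Cs) as Cs , here ,
  λ { (here g) → _ , g ; (there n _) → ⊥-elim (n refl) }
entryColumn {a ∷ as} {C ∷ Cs} {j} (_ ∷ I) (e ∷ T) (here refl) k | no n = ⊥-elim (n refl)
entryColumn {a ∷ as} {C ∷ Cs} {j} (_ ∷ I) (e ∷ T) (there j∈) k | no n
  rewrite dec-false (a ≟ j) n | +-suc k (posOf as j)
  with n′ , C′ , u , l , q , f , g ← entryColumn I T j∈ (suc k)
  with m , e′ ← posOf-suc j∈ =
  n′ , C′ , u , l ,
  trans (columnCells-rest (suc k) _ a C (trace as Cs) as Cs
          (λ e″ → m+1+n≢m k (trans (cong (k +_) (sym e′)) (suc-injective e″)))) q ,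
  there n ∘ f , λ { (here _) → ⊥-elim (n refl) ; (there _ H) → g H }

-- Below its last entry a column is continued by bumps.
tileIn : List Tile → ℕ → Tile
tileIn [] n = bump
tileIn (z ∷ C) zero = z
tileIn (z ∷ C) (suc n) = tileIn C n

tileInCols : Cols → ℕ → ℕ → Tile
tileInCols [] k r = bump
tileInCols (C ∷ Cs) zero r = tileIn C r
tileInCols (C ∷ Cs) (suc k) r = tileInCols Cs k r

bumpAbove-tileIn : ∀ p C r → bumpAbove p C (suc r) ≡ isBump (tileIn C r)
bumpAbove-tileIn p [] r = refl
bumpAbove-tileIn p (z ∷ C) zero = refl
bumpAbove-tileIn p (z ∷ C) (suc r) = bumpAbove-tileIn (isBump z) C r

tileAt-zero : ∀ P k → tileAt P 0 k ≡ nothing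
tileAt-zero [] k = refl
tileAt-zero (ρ ∷ P) k = refl

tileAt-suc : ∀ ρ P r k → tileAt (ρ ∷ P) (suc (suc r)) k ≡ tileAt P (suc r) k
tileAt-suc ρ P r k with nth P (suc r)
... | nothing = refl
... | just _ = refl

tileAt'-cong : ∀ P r k Q s l → tileAt P r k ≡ tileAt Q s l → tileAt' P r k ≡ tileAt' Q s l
tileAt'-cong P r k Q s l e with tileAt P r k | tileAt Q s l
tileAt'-cong _ _ _ _ _ _ refl | nothing | nothing = refl
tileAt'-cong _ _ _ _ _ _ refl | just _ | just _ = refl

tileAt-first : ∀ {R} r → SameLen C R → r ≤ length C → tileAt (addCol C R) (suc r) 1 ≡ just (tileIn C r)
tileAt-first zero [] l = refl
tileAt-first zero (z ∷ _) l = refl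
tileAt-first {z ∷ C} {ρ ∷ R} (suc r) (_ ∷ e) (s≤s l) =
  trans (tileAt-suc (z ∷ ρ) (addCol C R) r 1) (tileAt-first r e l)

tileAt'-first : ∀ {R} r → SameLen C R → tileAt' (addCol C R) (suc r) 1 ≡ tileIn C r
tileAt'-first zero [] = refl
tileAt'-first (suc r) [] = refl
tileAt'-first zero (z ∷ _) = refl
tileAt'-first {z ∷ C} {ρ ∷ R} (suc r) (_ ∷ e) =
  trans (tileAt'-cong ((z ∷ ρ) ∷ addCol C R) (suc (suc r)) 1 (addCol C R) (suc r) 1
           (tileAt-suc (z ∷ ρ) (addCol C R) r 1))
        (tileAt'-first r e)

tileAt-rest : ∀ {R} r k → SameLen C R → tileAt (addCol C R) r (suc (suc k)) ≡ tileAt R r (suc k)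
tileAt-rest {C} {R} zero k e = trans (tileAt-zero (addCol C R) _) (sym (tileAt-zero R _))
tileAt-rest (suc zero) k [] = refl
tileAt-rest (suc (suc r)) k [] = refl
tileAt-rest (suc zero) k (_ ∷ e) = refl
tileAt-rest {z ∷ C} {ρ ∷ R} (suc (suc r)) k (_ ∷ e) =
  trans (tileAt-suc (z ∷ ρ) (addCol C R) r (suc (suc k)))
    (trans (tileAt-rest (suc r) k e) (sym (tileAt-suc ρ R r (suc k))))

tileAt'-fromCols : ∀ r k → Tri as Cs → tileAt' (fromCols Cs) (suc r) (suc k) ≡ tileInCols Cs k r
tileAt'-fromCols r k [] = refl
tileAt'-fromCols {Cs = C ∷ _} r zero (e ∷ T) = tileAt'-first r (sameLen-fromCols {C = C} T e)
tileAt'-fromCols {Cs = C ∷ Cs} r (suc k) (e ∷ T) =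
  trans (tileAt'-cong (addCol C (fromCols Cs)) (suc r) (suc (suc k)) (fromCols Cs) (suc r) (suc k)
          (tileAt-rest (suc r) k (sameLen-fromCols {C = C} T e)))
        (tileAt'-fromCols r k T)

notUnmarkedBump-isBump : ∀ z → notUnmarkedBump (just z) ≡ not (isBump z)
notUnmarkedBump-isBump cross = refl
notUnmarkedBump-isBump bump = refl
notUnmarkedBump-isBump mbump = refl

tileAbove : Tri as Cs → PipeMeet k as Cs r s z b →
            notUnmarkedBump (tileAt (fromCols Cs) r (suc k)) ≡ not (bumpAbove′ Cs k r)
tileAbove {Cs = C ∷ Cs} {r = zero} (e ∷ T) (here m) =
  cong notUnmarkedBump (tileAt-zero (addCol C (fromCols Cs)) 1)
tileAbove {Cs = C ∷ Cs} {r = suc r} (e ∷ T) (here m) =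
  trans (cong notUnmarkedBump (tileAt-first {C = C} r (sameLen-fromCols T e) (<⇒≤ (<⇒≤ (Meet-row< m)))))
    (trans (notUnmarkedBump-isBump (tileIn C r)) (cong not (sym (bumpAbove-tileIn false C r))))
tileAbove {Cs = C ∷ Cs} {k = suc k} {r = r} (e ∷ T) (there m) =
  trans (cong notUnmarkedBump (tileAt-rest r k (sameLen-fromCols {C = C} T e))) (tileAbove T m)

traverses⁺ : ∀ i k z → s ≡ j ⊎ b ≡ j → traverses j (mkCell i k z (just s) (just b)) ≡ true
traverses⁺ {s} {j} i k z (inj₁ e) rewrite dec-true (s ≟ j) e = refl
traverses⁺ {s} {j} {b} i k z (inj₂ e) rewrite dec-true (b ≟ j) e = ∨-zeroʳ (s ≡ᵇ j)

traverses⁻ : ∀ i k z → traverses j (mkCell i k z (just s) (just b)) ≡ true → s ≡ j ⊎ b ≡ j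
traverses⁻ {j} {s} {b} i k z e with s ≟ j | b ≟ j
... | yes q | _ = inj₁ q
... | _ | yes q = inj₂ q
... | no n | no n′ rewrite dec-false (s ≟ j) n | dec-false (b ≟ j) n′ with () ← e

imp⁻ : ∀ {p q r} → not (p ∧ q) ∨ r ≡ true → p ≡ true → q ≡ true → r ≡ true
imp⁻ e refl refl = e

imp⁺ : ∀ p q {r} → (p ≡ true → q ≡ true → r ≡ true) → not (p ∧ q) ∨ r ≡ true
imp⁺ true true f = f refl refl
imp⁺ true false f = refl
imp⁺ false q f = refl

nand⁺ : ∀ p q → (p ≡ true → q ≡ true → ⊥) → not (p ∧ q) ≡ true
nand⁺ true true f = ⊥-elim (f refl refl)
nand⁺ true false f = refl
nand⁺ false q f = refl

not-true : ∀ {p} → not p ≡ true → p ≡ false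
not-true {false} e = refl

removable⇒Rem : Unique v → Tri (sort v) Cs → j ∈ v → removable? v (fromCols Cs) j ≡ true →
                Rem j (sort v) Cs
removable⇒Rem {v} {Cs} {j} U T j∈ e with ∧-true⁻ e
... | e₁ , e₂₃ with ∧-true⁻ e₂₃ | entryColumn (Inc-sort U) T (sort-∈⁺ v j∈) 0
...   | e₂ , e₃ | _ , C , u , l , q , f , _ = rem⁺ (Inc-sort U) T (f (proj₂ hook)) passable
  where
  hook : ∃[ r ] Hook r C
  hook = colPhase1⇒Hook 1 l
    (trans (cong (colPhase1 j) (sym (trans (cellsOf-columns v (colOf v j) T) q))) e₁)
  passable : AllPassable j (sort v) Cs
  passable {k} {r} {s} {z} {b} m i = noBump , noMark
    where
    noBump : z ≡ cross → bumpAbove′ Cs k r ≡ false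
    noBump refl = not-true (trans (sym (tileAbove T m))
      (imp⁻ {p = true} (allᵇ⁻ _ _ e₂ (cell∈ v T m)) refl (traverses⁺ {s} {j} {b} 0 0 cross i)))
    noMark : z ≢ mbump
    noMark refl = true≢false (trans (sym (allᵇ⁻ _ _ e₃ (cell∈ v T m)))
      (cong not (traverses⁺ {s} {j} {b} 0 0 cross i)))

Rem-∈ : PipeIns j r as Cs as′ Cs′ → j ∈ as′
Rem-∈ (enter g) = here refl
Rem-∈ (pass ne P c) = there (Rem-∈ P)

Rem⇒removable : Unique v → Tri (sort v) Cs → Rem j (sort v) Cs → removable? v (fromCols Cs) j ≡ true
Rem⇒removable {v} {Cs} {j} U T (_ , _ , _ , P)
  with entryColumn (Inc-sort U) T (Rem-∈ P) 0
... | _ , C , u , l , q , _ , g =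
  cong₂ _∧_ hook (cong₂ _∧_ (allᵇ⁺ _ _ noBump) (allᵇ⁺ _ _ noMark))
  where
  L : AllPassable j (sort v) Cs
  L = rem⇒AllPassable (Inc-sort U) T P
  hook : colPhase1 j (columnCells (colOf v j) (cellsOf v (fromCols Cs))) ≡ true
  hook = trans (cong (colPhase1 j) (trans (cellsOf-columns v (colOf v j) T) q))
               (Hook⇒colPhase1 1 l (proj₂ (g (rem⇒HookAt P))))
  noBump : ∀ {c} → c ∈ cellsOf v (fromCols Cs) →
           not (isCross (tile c) ∧ traverses j c) ∨
           notUnmarkedBump (tileAt (fromCols Cs) (row c ∸ 1) (col c)) ≡ true
  noBump c∈ with cellsOf-view v T c∈
  ... | diagonal = refl
  ... | meeting {m = k} {r = r} {s = s} {z = z} {b = b} m refl =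
    imp⁺ (isCross z) (traverses j (mkCell (suc r) (suc k) z (just s) (just b)))
      λ e e′ → trans (tileAbove T m) (cong not (proj₁ (L m (traverses⁻ (suc r) (suc k) z e′)) (isCross⁻ z e)))
    where
    isCross⁻ : ∀ z → isCross z ≡ true → z ≡ cross
    isCross⁻ cross e = refl
  noMark : ∀ {c} → c ∈ cellsOf v (fromCols Cs) → not (isMBump (tile c) ∧ traverses j c) ≡ true
  noMark c∈ with cellsOf-view v T c∈
  ... | diagonal = refl
  ... | meeting {m = k} {r = r} {s = s} {z = z} {b = b} m refl =
    nand⁺ (isMBump z) (traverses j (mkCell (suc r) (suc k) z (just s) (just b)))
      λ e e′ → proj₂ (L m (traverses⁻ (suc r) (suc k) z e′)) (isMBump⁻ z e)
    where
    isMBump⁻ : ∀ z → isMBump z ≡ true → z ≡ mbump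
    isMBump⁻ mbump e = refl

-- The map `phi` deletes a threaded pipe.

rightOfEntry : PipeIns j r as Cs as′ Cs′ → posOf as′ j ≤ suc k →
               tileInCols Cs k n ≡ tileInCols Cs′ (suc k) n
rightOfEntry (enter g) l = refl
rightOfEntry {j} {as′ = a ∷ as′} {k = k} (pass ne P c) l rewrite dec-false (a ≟ j) ne
  with posOf-suc (Rem-∈ P)
rightOfEntry {k = zero} (pass ne P c) (s≤s l) | _ , e rewrite e with () ← l
rightOfEntry {k = suc k} (pass ne P c) (s≤s l) | _ , _ = rightOfEntry P l

At⇒Meet : SameLen C u → At u n x → ∃[ s ] Meet a C u n s (tileIn C n) x
At⇒Meet (z ∷ l) here = _ , here
At⇒Meet (z ∷ l) (there p) = let _ , m = At⇒Meet l p in _ , there m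

leftOfEntry : PipeIns j r as Cs as′ Cs′ → Tri as′ Cs′ → suc k < posOf as′ j →
  ∃[ s ] ∃[ t ] ∃[ C ] ∃[ C′ ] ∃[ b ] (ColIns false s t C C′ × PipeMeet k as′ Cs′ s b (tileIn C′ s) j ×
    (∀ n → tileInCols Cs k n ≡ tileIn C n) × (∀ n → tileInCols Cs′ k n ≡ tileIn C′ n))
leftOfEntry {j} (enter g) T l rewrite dec-true (j ≟ j) refl with s≤s () ← l
leftOfEntry {k = zero} (pass ne P c) (e ∷ T) l =
  let _ , m = At⇒Meet (sameLen-trace T e) (Ins⇒At (PipeIns-trace P T))
  in _ , _ , _ , _ , _ , c , here m , (λ _ → refl) , λ _ → refl
leftOfEntry {j} {as′ = a ∷ as′} {k = suc k} (pass ne P c) (e ∷ T) l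
  rewrite dec-false (a ≟ j) ne =
  let _ , _ , _ , _ , _ , c′ , m , f , f′ = leftOfEntry P T (≤-pred l)
  in _ , _ , _ , _ , _ , c′ , there m , f , f′

Meet-tile : Meet a C u r s z b → z ≡ tileIn C r
Meet-tile here = refl
Meet-tile (there m) = Meet-tile m

-- The labels on the right of a column are distinct. So the cell found by `firstRightCell` is the
-- one where the threaded pipe comes in.
PipeMeet-right : Inc as → Tri as Cs → PipeMeet k as Cs r s z b → PipeMeet k as Cs r′ t z′ b →
                 r ≡ r′ × z ≡ z′
PipeMeet-right (_ ∷ I) (e ∷ T) (here m) (here m′)
  with At-unique (Unique-trace I T) (Meet-right m) (Meet-right m′)
... | refl = refl , trans (Meet-tile m) (sym (Meet-tile m′))
PipeMeet-right (_ ∷ I) (e ∷ T) (there m) (there m′) = PipeMeet-right I T m m′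

firstRightCell-just : ∀ {i t} cs → mkCell i k z t (just j) ∈ cs →
  ∃[ c ] (firstRightCell j k cs ≡ just c × c ∈ cs × col c ≡ k × right c ≡ just j)
firstRightCell-just {k} {z} {j} (d ∷ cs) c∈ with col d ≟ k | isLbl (right d) j in e
firstRightCell-just {k} {z} {j} (d ∷ cs) c∈ | yes q | true
  rewrite dec-true (col d ≟ k) q = d , refl , here refl , q , label (right d) e
  where
  label : ∀ t → isLbl t j ≡ true → t ≡ just j
  label (just x) e = cong just (≡ᵇ⇒≡ x j (subst T (sym e) tt))
firstRightCell-just {k} {z} {j} (d ∷ cs) (here refl) | no q | _ = ⊥-elim (q refl)
firstRightCell-just {k} {z} {j} (d ∷ cs) (there m) | no q | _
  rewrite dec-false (col d ≟ k) q =
  let c , e₁ , m′ , q′ = firstRightCell-just cs m in c , e₁ , there m′ , q′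
firstRightCell-just {k} {z} {j} (d ∷ cs) (here refl) | yes q | false =
  ⊥-elim (true≢false (trans (sym (dec-true (j ≟ j) refl)) e))
firstRightCell-just {k} {z} {j} (d ∷ cs) (there m) | yes q | false
  rewrite dec-true (col d ≟ k) q =
  let c , e₁ , m′ , q′ = firstRightCell-just cs m in c , e₁ , there m′ , q′

rowIn-just : ∀ {c} cs → firstRightCell j k cs ≡ just c → rowIn j k cs ≡ row c
rowIn-just cs e rewrite e = refl

crossCase-just : ∀ {c} cs → firstRightCell j k cs ≡ just c → crossCase j k cs ≡ isCross (tile c)
crossCase-just cs e rewrite e = refl

rightCell : ∀ v → Inc (sort v) → Tri (sort v) Cs → PipeMeet k (sort v) Cs r s z j →
            rowIn j (suc k) (cellsOf v (fromCols Cs)) ≡ suc r ×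
            crossCase j (suc k) (cellsOf v (fromCols Cs)) ≡ isCross z
rightCell v I T m with firstRightCell-just _ (cell∈ v T m)
... | c , e , c∈ , e₁ , e₂ with cellsOf-view v T c∈
rightCell v I T m | c , e , c∈ , e₁ , () | diagonal
rightCell {Cs} v I T m | c , e , c∈ , refl , refl | meeting m′ refl with PipeMeet-right I T m m′
... | refl , refl = rowIn-just (cellsOf v (fromCols Cs)) e , crossCase-just (cellsOf v (fromCols Cs)) e

-- With the next two lemmas, the effect of Φ_j on a column left of the entry: the tile of row `r` is
-- dropped and the lower ones move up, and in the bump case row `r` again holds a bump.
ColIns-above : ColIns p r r′ C C′ → n < r → tileIn C n ≡ tileIn C′ n
ColIns-above {n = zero} (skip c) l = refl
ColIns-above {n = suc n} (skip c) (s≤s l) = ColIns-above c l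

ColIns-below : ColIns p r r′ C C′ → r ≤ n → tileIn C n ≡ tileIn C′ (suc n)
ColIns-below crossing l = refl
ColIns-below last l = refl
ColIns-below double l = refl
ColIns-below (skip c) (s≤s l) = ColIns-below c l

ColIns-at : ColIns p r r′ C C′ → isCross (tileIn C′ r) ≡ false → tileIn C r ≡ bump
ColIns-at last e = refl
ColIns-at double e = refl
ColIns-at (skip c) e = ColIns-at c e

-- The tile function local to `phi`, given a name to be reasoned about.
newTile : List ℕ → ℕ → PipeDream → ℕ → ℕ → Tile
newTile v j P r k =
  if colOf v j ≤ᵇ k then tileAt' P r (suc k)
  else (if r <ᵇ rowIn j k (cellsOf v P) then tileAt' P r k
  else (if crossCase j k (cellsOf v P) then tileAt' P (suc r) k
  else (if r ≡ᵇ rowIn j k (cellsOf v P) then bump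
  else tileAt' P (suc r) k)))

newTile≡ : ∀ v → Inc (sort v) → Tri (sort v) Cs′ → PipeIns j r as Cs (sort v) Cs′ → ∀ n k →
           newTile v j (fromCols Cs′) (suc n) (suc k) ≡ tileInCols Cs k n
newTile≡ {Cs′ = Cs′} {j = j} v I T P n k with colOf v j ≤? suc k
... | yes l rewrite dec-true (colOf v j ≤? suc k) l =
  trans (tileAt'-fromCols n (suc k) T) (sym (rightOfEntry P l))
... | no l with leftOfEntry P T (≰⇒> l)
...   | s , _ , C , C′ , _ , c , m , f , f′
  rewrite dec-false (colOf v j ≤? suc k) l | proj₁ (rightCell v I T m) | proj₂ (rightCell v I T m)
  with n <? s
...     | yes n<s rewrite dec-true (n <? s) n<s =
  trans (tileAt'-fromCols n k T) (trans (f′ n) (trans (sym (ColIns-above c n<s)) (sym (f n))))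
...     | no n≮s rewrite dec-false (n <? s) n≮s with isCross (tileIn C′ s) in e
...       | true =
  trans (tileAt'-fromCols (suc n) k T)
    (trans (f′ (suc n)) (trans (sym (ColIns-below c (≮⇒≥ n≮s))) (sym (f n))))
...       | false with n ≟ s
...         | yes refl rewrite dec-true (n ≟ n) refl = trans (sym (ColIns-at c e)) (sym (f n))
...         | no n≢s rewrite dec-false (n ≟ s) n≢s =
  trans (tileAt'-fromCols (suc n) k T)
    (trans (f′ (suc n)) (trans (sym (ColIns-below c (≮⇒≥ n≮s))) (sym (f n))))

grid : (ℕ → ℕ → Tile) → ℕ → PipeDream
grid f n = applyUpTo (λ r → applyUpTo (f r) (n ∸ r)) n

addCol-grid : ∀ C f → (∀ r → f r 0 ≡ tileIn C r) →
              addCol C (grid (λ r k → f r (suc k)) (length C)) ≡ grid f (suc (length C))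
addCol-grid [] f e = cong (λ z → (z ∷ []) ∷ []) (sym (e 0))
addCol-grid (z ∷ C) f e =
  cong₂ (λ z′ R → (z′ ∷ applyUpTo (f 0 ∘ suc) (suc (length C))) ∷ R) (sym (e 0))
        (addCol-grid C (f ∘ suc) (e ∘ suc))

fromCols-grid : Tri as Cs → ∀ f → (∀ r k → f r k ≡ tileInCols Cs k r) → fromCols Cs ≡ grid f (length as)
fromCols-grid [] f e = refl
fromCols-grid {Cs = C ∷ Cs} (e ∷ T) f q =
  trans (cong (addCol C) (trans (fromCols-grid T (λ r k → f r (suc k)) (λ r k → q r (suc k)))
                                (cong (grid _) (sym e))))
    (trans (addCol-grid C f (λ r → q r 0)) (cong (grid f ∘ suc) e))

rows≡grid : ∀ (f : ℕ → ℕ → Tile) n →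
            map (λ r → map (f r) (from1 (suc n ∸ r))) (from1 n) ≡ grid (λ r k → f (suc r) (suc k)) n
rows≡grid f n =
  trans (map-cong (λ r → from1-applyUpTo (f r) (suc n ∸ r)) (from1 n))
        (from1-applyUpTo (λ r → applyUpTo (f r ∘ suc) (suc n ∸ r)) n)
  where
  from1-applyUpTo : ∀ {A : Set} (f : ℕ → A) n → map f (from1 n) ≡ applyUpTo (f ∘ suc) n
  from1-applyUpTo f n = trans (sym (map-∘ (upTo n))) (map-upTo (f ∘ suc) n)

phi-fromCols : ∀ v → Inc (sort v) → Tri (sort v) Cs′ → PipeIns j r as Cs (sort v) Cs′ →
               phi v j (fromCols Cs′) ≡ fromCols Cs
phi-fromCols {Cs′} {j} {as = as} {Cs = Cs} v I T P = trans (size (length v) length-v) grids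
  where
  f = newTile v j (fromCols Cs′)
  length-v : length v ≡ suc (length as)
  length-v = trans (sym (length-sort v)) (PipeIns-length P)
  -- The rank is generalised to `m` so that it can be replaced by a successor and the subtractions
  -- compute.
  size : ∀ m → m ≡ suc (length as) →
         map (λ r → map (f r) (from1 (m ∸ r))) (from1 (m ∸ 1)) ≡
         grid (λ r k → f (suc r) (suc k)) (length as)
  size m refl = rows≡grid f (length as)
  grids = sym (fromCols-grid (PipeIns-Tri P T) (λ r k → f (suc r) (suc k)) (newTile≡ v I T P))

-- The reduction map

-- Avoidance phrased with sublists rather than positions, so that subwords inherit it by
-- transitivity.
Avoids : List ℕ → Set
Avoids w = ∀ {a b c d} → a ∷ b ∷ c ∷ d ∷ [] ⊆ w → a < c → c < d → d < b → ⊥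

index : {v w : List ℕ} → v ⊆ w → Fin (length v) → Fin (length w)
index (y ∷ʳ σ) i = Fin.suc (index σ i)
index (e ∷ σ) Fin.zero = Fin.zero
index (e ∷ σ) (Fin.suc i) = Fin.suc (index σ i)

index-mono : ∀ {v w} (σ : v ⊆ w) {i k} → i Fin.< k → index σ i Fin.< index σ k
index-mono (y ∷ʳ σ) l = s≤s (index-mono σ l)
index-mono (e ∷ σ) {Fin.zero} {Fin.suc k} l = s≤s z≤n
index-mono (e ∷ σ) {Fin.suc i} {Fin.suc k} (s≤s l) = s≤s (index-mono σ l)

lookup-index : ∀ {v w} (σ : v ⊆ w) i → lookup w (index σ i) ≡ lookup v i
lookup-index (y ∷ʳ σ) i = lookup-index σ i
lookup-index (refl ∷ σ) Fin.zero = refl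
lookup-index (refl ∷ σ) (Fin.suc i) = lookup-index σ i

avoids : Avoids1423 w → Avoids w
avoids A σ a<c c<d d<b =
  A (index σ i₁) (index σ i₂) (index σ i₃) (index σ i₄)
    (index-mono σ (s≤s z≤n)) (index-mono σ (s≤s (s≤s z≤n))) (index-mono σ (s≤s (s≤s (s≤s z≤n))))
    ( subst₂ _<_ (sym (lookup-index σ i₁)) (sym (lookup-index σ i₃)) a<c
    , subst₂ _<_ (sym (lookup-index σ i₃)) (sym (lookup-index σ i₄)) c<d
    , subst₂ _<_ (sym (lookup-index σ i₄)) (sym (lookup-index σ i₂)) d<b )
  where
  i₁ i₂ i₃ i₄ : Fin 4
  i₁ = Fin.zero
  i₂ = Fin.suc Fin.zero
  i₃ = Fin.suc (Fin.suc Fin.zero)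
  i₄ = Fin.suc (Fin.suc (Fin.suc Fin.zero))

drop-⊆ : Ins n j u v → x ∈ drop n u → j ∷ x ∷ [] ⊆ v
drop-⊆ zero m = refl ∷ from∈ m
drop-⊆ (suc q) m = _ ∷ʳ drop-⊆ q m

take-drop-⊆ : Ins n j u v → b ∈ take n u → x ∈ drop n u → b ∷ j ∷ x ∷ [] ⊆ v
take-drop-⊆ (suc q) (here refl) m = refl ∷ drop-⊆ q m
take-drop-⊆ (suc q) (there m′) m = _ ∷ʳ take-drop-⊆ q m′ m

Pat⇒⊆ : Ins n j u v → Pat j x (take n u) → x ∈ drop n u →
        ∃[ a ] ∃[ b ] (a < j × x < b × a ∷ b ∷ j ∷ x ∷ [] ⊆ v)
Pat⇒⊆ (suc q) (here l m l′) m′ = _ , _ , l , l′ , refl ∷ take-drop-⊆ q m m′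
Pat⇒⊆ (suc q) (there P) m′ =
  let a , b , l , l′ , σ = Pat⇒⊆ q P m′ in a , b , l , l′ , _ ∷ʳ σ

avoids⇒NoPat : Avoids v → Ins n j u v → NoPat j n [] u
avoids⇒NoPat A q x j<x m P = let _ , _ , l , l′ , σ = Pat⇒⊆ q P m in A σ l j<x l′

Ins-≤ : Ins n j u v → n ≤ length u
Ins-≤ zero = z≤n
Ins-≤ (suc q) = s≤s (Ins-≤ q)

Ins-unique : Ins n j u v → Ins n j u w → v ≡ w
Ins-unique zero zero = refl
Ins-unique (suc q) (suc q′) = cong (_ ∷_) (Ins-unique q q′)

Unique-⊆ : v ⊆ w → Unique w → Unique v
Unique-⊆ [] U = []
Unique-⊆ (y ∷ʳ σ) (_ ∷ U) = Unique-⊆ σ U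
Unique-⊆ (refl ∷ σ) (d ∷ U) = All-resp-⊆ σ d ∷ Unique-⊆ σ U

delete-⊆ : ∀ j v → deleteLbl j v ⊆ v
delete-⊆ j v = filterᵇ-⊆ _ v

PipeIns-Ins : PipeIns j r as Cs as′ Cs′ → ∃[ n ] Ins n j as as′
PipeIns-Ins (enter g) = 0 , zero
PipeIns-Ins (pass ne P c) = let n , q = PipeIns-Ins P in suc n , suc q

PipeIns-delete : Inc as′ → PipeIns j r as Cs as′ Cs′ → as ≡ deleteLbl j as′
PipeIns-delete I P = let _ , q = PipeIns-Ins P in sym (delete-Ins q (Ins-∉ q I))

Ins-word : Unique v → Ins n j u v → u ≡ deleteLbl j v
Ins-word U q = sym (delete-Ins q (∉ q U))
  where
  ∉ : Ins n j u v → Unique v → j ∉ u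
  ∉ zero (d ∷ _) = ∉-All d
  ∉ (suc q) (d ∷ U) (here refl) = ∉-All d (Ins-here q)
  ∉ (suc q) (d ∷ U) (there m) = ∉ q U m

Bool-ext : ∀ {p q} → (p ≡ true → q ≡ true) → (q ≡ true → p ≡ true) → p ≡ q
Bool-ext {true} f g = sym (f refl)
Bool-ext {false} {true} f g = g refl
Bool-ext {false} {false} f g = refl

removal : Unique v → MRPD v Cs′ → j ∈ v → removable? v (fromCols Cs′) j ≡ true →
          ∃[ r ] ∃[ Cs ] (PipeIns j r (sort (deleteLbl j v)) Cs (sort v) Cs′)
removal {v} {j = j} U M j∈ e with removable⇒Rem U (tri M) j∈ e
... | r , as , Cs , P
  with refl ← trans (PipeIns-delete (Inc-sort U) P) (delete-sort j U) = r , Cs , P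

MRPD-delete : Unique v → MRPD v Cs′ → PipeIns j r (sort (deleteLbl j v)) Cs (sort v) Cs′ →
              MRPD (deleteLbl j v) Cs
MRPD-delete U (mrpd T V W) P =
  mrpd (PipeIns-Tri P T) (PipeIns-valid⁻ P T V)
    (Ins-word U (subst (Ins _ _ _) W (PipeIns-trace P T)))

removable-stable : Unique v → MRPD v Cs′ → PipeIns j r (sort (deleteLbl j v)) Cs (sort v) Cs′ →
                   i ∈ deleteLbl j v →
                   removable? (deleteLbl j v) (fromCols Cs) i ≡ removable? v (fromCols Cs′) i
removable-stable {v} {j = j} {i = i} U M P i∈ with delete-∈⁻ j v i∈
... | i∈v , i≢j =
  Bool-ext
    (λ e → Rem⇒removable U (tri M) (Rem-ins i≢j P (tri M) (removable⇒Rem U′ (PipeIns-Tri P (tri M)) i∈ e)))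
    (λ e → Rem⇒removable U′ (PipeIns-Tri P (tri M)) (Rem-del i≢j P (removable⇒Rem U (tri M) i∈v e)))
  where
  U′ = Unique-⊆ (delete-⊆ j v) U

phi-MRPD : ∀ {P} → Unique v → IsMRPD v P → j ∈ v → removable? v P j ≡ true →
           IsMRPD (deleteLbl j v) (phi v j P) ×
           (∀ {i} → i ∈ deleteLbl j v → removable? (deleteLbl j v) (phi v j P) i ≡ removable? v P i)
phi-MRPD {v} {j} {P} U m j∈ e with IsMRPD⇒MRPD P U m
... | Cs′ , refl , M with removal U M j∈ e
...   | r , Cs , Q rewrite phi-fromCols v (Inc-sort U) (tri M) Q =
  MRPD⇒IsMRPD (Unique-⊆ (delete-⊆ j v) U) (MRPD-delete U M Q) , removable-stable U M Q

phi-injective : ∀ {P P′} → Unique v → IsMRPD v P → IsMRPD v P′ → j ∈ v →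
                removable? v P j ≡ true → removable? v P′ j ≡ true →
                phi v j P ≡ phi v j P′ → P ≡ P′
phi-injective {v} {j} {P} {P′} U m m′ j∈ e e′ q with IsMRPD⇒MRPD P U m | IsMRPD⇒MRPD P′ U m′
... | Cs , refl , M | Cs′ , refl , M′ with removal U M j∈ e | removal U M′ j∈ e′
...   | r , Ds , Q | r′ , Ds′ , Q′
  with refl ← fromCols-injective (PipeIns-Tri Q (tri M)) (PipeIns-Tri Q′ (tri M′))
                (trans (sym (phi-fromCols v (Inc-sort U) (tri M) Q))
                  (trans q (phi-fromCols v (Inc-sort U) (tri M′) Q′)))
  -- Both exit rows are the position of `j` in `v`.
  with refl ← At-unique U (subst (λ u → At u r j) (word M) (Ins⇒At (PipeIns-trace Q (tri M))))
                          (subst (λ u → At u r′ j) (word M′) (Ins⇒At (PipeIns-trace Q′ (tri M′))))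
  = cong fromCols (PipeIns-unique Q Q′ (tri M) (tri M′))

-- The position of `j` in `v` prescribes the exit row of the new pipe, and avoidance in `v` supplies
-- `NoPat` at the left boundary, where the insertion starts.
phi-surjective : ∀ {R} → Unique v → Avoids v → j ∈ v → IsMRPD (deleteLbl j v) R →
                 ∃[ P ] (IsMRPD v P × removable? v P j ≡ true × phi v j P ≡ R)
phi-surjective {v} {j} {R} U A j∈ m with IsMRPD⇒MRPD R (Unique-⊆ (delete-⊆ j v) U) m
... | Cs , refl , mrpd T V W
  with r , q ← Ins-delete U j∈
  with n , q′ ← Ins-delete (Inc⇒Unique (Inc-sort U)) (sort-∈⁺ v j∈)
  with Cs′ , P , T′ , V′ ← PipeIns-exists (subst (λ u → Ins n j u (sort v)) (delete-sort j U) q′)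
         (Inc-sort U) T V
         (≤-trans (Ins-≤ q) (≤-reflexive (sym (length-sort (deleteLbl j v)))))
         (subst (NoPat j r []) (sym W) (avoids⇒NoPat A q))
  = fromCols Cs′ ,
    MRPD⇒IsMRPD U (mrpd T′ V′ (Ins-unique (subst (λ u → Ins r j u _) W (PipeIns-trace P T′)) q)) ,
    Rem⇒removable U T′ (r , _ , _ , P) ,
    phi-fromCols v (Inc-sort U) T′ P

-- Removing several pipes in succession.

deleteAll : List ℕ → List ℕ → List ℕ
deleteAll [] w = w
deleteAll (j ∷ js) w = deleteAll js (deleteLbl j w)

applyAll-word : ∀ w js P → proj₁ (applyAll w js P) ≡ deleteAll js w
applyAll-word w [] P = refl
applyAll-word w (j ∷ js) P = applyAll-word (deleteLbl j w) js (phi w j P)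

deleteAll-⊆ : ∀ js w → deleteAll js w ⊆ w
deleteAll-⊆ [] w = ⊆-refl
deleteAll-⊆ (j ∷ js) w = ⊆-trans (deleteAll-⊆ js (deleteLbl j w)) (delete-⊆ j w)

deleteAll-∉ : ∀ js w → x ∈ deleteAll js w → x ∉ js
deleteAll-∉ (j ∷ js) w m (here e) =
  proj₂ (delete-∈⁻ j w (Any-resp-⊆ (deleteAll-⊆ js (deleteLbl j w)) m)) e
deleteAll-∉ (j ∷ js) w m (there m′) = deleteAll-∉ js (deleteLbl j w) m m′

deleteAll-∈ : ∀ js w → x ∈ w → x ∉ js → x ∈ deleteAll js w
deleteAll-∈ [] w m n = m
deleteAll-∈ (j ∷ js) w m n = deleteAll-∈ js (deleteLbl j w) (delete-∈⁺ j w m (n ∘ here)) (n ∘ there)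

module _ {js : List ℕ} {w : List ℕ} (U : Unique (j ∷ js)) (js∈ : All (_∈ w) (j ∷ js)) where
  rest∈ : All (_∈ deleteLbl j w) js
  rest∈ = All.tabulate λ m →
    delete-∈⁺ j w (All.lookup js∈ (there m)) λ { refl → ∉-All (head U) m }
    where
    head : Unique (j ∷ js) → All (j ≢_) js
    head (d ∷ _) = d

applyAll-MRPD : ∀ {P} js w → Unique w → Unique js → All (_∈ w) js → IsMRPD w P →
  (∀ {j} → j ∈ js → removable? w P j ≡ true) →
  IsMRPD (deleteAll js w) (proj₂ (applyAll w js P)) ×
  (∀ {i} → i ∈ deleteAll js w →
    removable? (deleteAll js w) (proj₂ (applyAll w js P)) i ≡ removable? w P i)
applyAll-MRPD [] w U Uj js∈ m f = m , λ _ → refl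
applyAll-MRPD (j ∷ js) w U Uj@(_ ∷ Uj′) js∈@(j∈ ∷ _) m f =
  let m′ , g = phi-MRPD U m j∈ (f (here refl))
      rest = rest∈ Uj js∈
      m″ , h = applyAll-MRPD js (deleteLbl j w) (Unique-⊆ (delete-⊆ j w) U) Uj′ rest m′
                 (λ k∈ → trans (g (All.lookup rest k∈)) (f (there k∈)))
  in m″ , λ i∈ → trans (h i∈) (g (Any-resp-⊆ (deleteAll-⊆ js (deleteLbl j w)) i∈))

applyAll-injective : ∀ {P P′} js w → Unique w → Unique js → All (_∈ w) js →
  IsMRPD w P → IsMRPD w P′ →
  (∀ {j} → j ∈ js → removable? w P j ≡ true) → (∀ {j} → j ∈ js → removable? w P′ j ≡ true) →
  applyAll w js P ≡ applyAll w js P′ → P ≡ P′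
applyAll-injective [] w U Uj js∈ m m′ f f′ e = cong proj₂ e
applyAll-injective (j ∷ js) w U Uj@(_ ∷ Uj′) js∈@(j∈ ∷ _) m m′ f f′ e =
  let n , g = phi-MRPD U m j∈ (f (here refl))
      n′ , g′ = phi-MRPD U m′ j∈ (f′ (here refl))
      rest = rest∈ Uj js∈
  in phi-injective U m m′ j∈ (f (here refl)) (f′ (here refl))
       (applyAll-injective js (deleteLbl j w) (Unique-⊆ (delete-⊆ j w) U) Uj′ rest n n′
         (λ k∈ → trans (g (All.lookup rest k∈)) (f (there k∈)))
         (λ k∈ → trans (g′ (All.lookup rest k∈)) (f′ (there k∈))) e)

-- The pipe removed last is reinserted first. All intermediate words are subwords of `w` and avoid
-- 1423 with it.
applyAll-surjective : ∀ {R} js w → Unique w → Avoids w → Unique js → All (_∈ w) js →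
  IsMRPD (deleteAll js w) R →
  ∃[ P ] (IsMRPD w P × applyAll w js P ≡ (deleteAll js w , R) ×
          (∀ {j} → j ∈ js → removable? w P j ≡ true) ×
          (∀ {i} → i ∈ deleteAll js w → removable? w P i ≡ removable? (deleteAll js w) R i))
applyAll-surjective {R} [] w U A Uj js∈ m = R , m , refl , (λ ()) , λ _ → refl
applyAll-surjective {R} (j ∷ js) w U A Uj@(_ ∷ Uj′) js∈@(j∈ ∷ _) m
  with P₁ , m₁ , e₁ , f₁ , g₁ ← applyAll-surjective js (deleteLbl j w)
         (Unique-⊆ (delete-⊆ j w) U) (λ σ → A (⊆-trans σ (delete-⊆ j w))) Uj′ (rest∈ Uj js∈) m
  with P , m₂ , e₂ , refl ← phi-surjective U A j∈ m₁
  = P , m₂ , e₁ ,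
    (λ { (here refl) → e₂
       ; (there k∈) → trans (sym (stable (All.lookup (rest∈ Uj js∈) k∈))) (f₁ k∈) }) ,
    λ i∈ → trans (sym (stable (Any-resp-⊆ (deleteAll-⊆ js (deleteLbl j w)) i∈))) (g₁ i∈)
  where
  stable = proj₂ (phi-MRPD U m₂ j∈ e₂)

-- When the letters of `w` are distinct, a subword is determined by which letters it keeps.
⊆-ext : Unique w → u ⊆ w → v ⊆ w → (∀ {x} → x ∈ u → x ∈ v) → (∀ {x} → x ∈ v → x ∈ u) → u ≡ v
⊆-ext U [] [] f g = refl
⊆-ext (_ ∷ U) (_ ∷ʳ σ) (_ ∷ʳ τ) f g = ⊆-ext U σ τ f g
⊆-ext (d ∷ U) (refl ∷ σ) (_ ∷ʳ τ) f g = ⊥-elim (∉-All d (Any-resp-⊆ τ (f (here refl))))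
⊆-ext (d ∷ U) (_ ∷ʳ σ) (refl ∷ τ) f g = ⊥-elim (∉-All d (Any-resp-⊆ σ (g (here refl))))
⊆-ext {x ∷ w} (d ∷ U) (refl ∷ σ) (refl ∷ τ) f g =
  cong (x ∷_) (⊆-ext U σ τ (λ m → tail (Any-resp-⊆ σ m) (f (there m)))
                           (λ m → tail (Any-resp-⊆ τ m) (g (there m))))
  where
  tail : ∀ {y v} → y ∈ w → y ∈ x ∷ v → y ∈ v
  tail m (here refl) = ⊥-elim (∉-All d m)
  tail m (there m′) = m′

removablePipes-∈ : ∀ w P → x ∈ removablePipes w P → removable? w P x ≡ true
removablePipes-∈ w P m = proj₂ (filterᵇ-∈⁻ (removable? w P) w m)

-- The three properties that make `Φ` a bijection onto the cores.

module _ {w : List ℕ} (U : Unique w) where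
  private
    pipes⊆ : ∀ P → removablePipes w P ⊆ w
    pipes⊆ P = filterᵇ-⊆ (removable? w P) w

    pipes∈ : ∀ P → All (_∈ w) (removablePipes w P)
    pipes∈ P = All.tabulate (Any-resp-⊆ (pipes⊆ P))

    Upipes : ∀ P → Unique (removablePipes w P)
    Upipes P = Unique-⊆ (pipes⊆ P) U

  -- The surviving pipes keep their removability status, and all that were removable are gone.
  Φ-core : ∀ P → IsMRPD w P → proj₁ (Φ w P) ⊆ w × IsCMRPD (proj₁ (Φ w P)) (proj₂ (Φ w P))
  Φ-core P m rewrite applyAll-word w (removablePipes w P) P
    with m′ , stable ← applyAll-MRPD (removablePipes w P) w U (Upipes P) (pipes∈ P) m (removablePipes-∈ w P)
    = deleteAll-⊆ js w , m′ , All.tabulate (λ i∈ → trans (stable i∈) (kept i∈))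
    where
    js = removablePipes w P
    kept : i ∈ deleteAll js w → removable? w P i ≡ false
    kept {i} i∈ with removable? w P i in e
    ... | false = refl
    ... | true = ⊥-elim (deleteAll-∉ js w i∈
                   (filterᵇ-∈⁺ (removable? w P) w (Any-resp-⊆ (deleteAll-⊆ js w) i∈) e))

  -- The resulting subword reveals which letters were deleted. So both pipe dreams have the same
  -- removable pipes and undergo the same sequence of injective steps.
  Φ-injective : ∀ P P′ → IsMRPD w P → IsMRPD w P′ → Φ w P ≡ Φ w P′ → P ≡ P′
  Φ-injective P P′ m m′ e =
    applyAll-injective js w U (Upipes P) (pipes∈ P) m m′ (removablePipes-∈ w P)
      (removablePipes-∈ w P′ ∘ subst (_ ∈_) js≡)
      (trans e (cong (λ ks → applyAll w ks P′) (sym js≡)))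
    where
    js = removablePipes w P
    js′ = removablePipes w P′
    words : deleteAll js w ≡ deleteAll js′ w
    words = trans (sym (applyAll-word w js P)) (trans (cong proj₁ e) (applyAll-word w js′ P′))
    transfer : ∀ ks ls → ks ⊆ w → deleteAll ks w ≡ deleteAll ls w → x ∈ ks → x ∈ ls
    transfer {x} ks ls σ q x∈ with x ∈? ls
    ... | yes m = m
    ... | no n = ⊥-elim (deleteAll-∉ ks w
                   (subst (x ∈_) (sym q) (deleteAll-∈ ls w (Any-resp-⊆ σ x∈) n)) x∈)
    js≡ : js ≡ js′
    js≡ = ⊆-ext U (pipes⊆ P) (pipes⊆ P′) (transfer js js′ (pipes⊆ P) words)
                                         (transfer js′ js (pipes⊆ P′) (sym words))

  -- The letters of `w` missing from `v` are reinserted and become removable. No letter of `v` is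
  -- removable, since the given pipe dream is a core and insertion preserves this, so `Φ` takes away
  -- exactly the new pipes.
  Φ-surjective : Avoids w → ∀ v R → v ⊆ w → IsCMRPD v R → ∃[ P ] (IsMRPD w P × Φ w P ≡ (v , R))
  Φ-surjective A v R σ (m , core) =
    P , mP , trans (cong (λ ks → applyAll w ks P) pipes≡) (trans eP (cong (_, R) words))
    where
    missing : ℕ → Bool
    missing x = not (does (x ∈? v))
    js = filterᵇ missing w
    js⊆ = filterᵇ-⊆ missing w
    missing⁻ : x ∈ js → x ∉ v
    missing⁻ {x} x∈ x∈v =
      true≢false (trans (sym (proj₂ (filterᵇ-∈⁻ missing w x∈))) (cong not (dec-true (x ∈? v) x∈v)))
    missing⁺ : x ∈ w → x ∉ v → x ∈ js
    missing⁺ {x} x∈ x∉v = filterᵇ-∈⁺ missing w x∈ (cong not (dec-false (x ∈? v) x∉v))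
    words : deleteAll js w ≡ v
    words = ⊆-ext U (deleteAll-⊆ js w) σ there⁻ (λ x∈ → deleteAll-∈ js w (Any-resp-⊆ σ x∈) (λ m → missing⁻ m x∈))
      where
      there⁻ : x ∈ deleteAll js w → x ∈ v
      there⁻ {x} x∈ with x ∈? v
      ... | yes m = m
      ... | no n = ⊥-elim (deleteAll-∉ js w x∈ (missing⁺ (Any-resp-⊆ (deleteAll-⊆ js w) x∈) n))
    lift = applyAll-surjective js w U A (Unique-⊆ js⊆ U) (All.tabulate (Any-resp-⊆ js⊆))
             (subst (λ u → IsMRPD u R) (sym words) m)
    P = proj₁ lift
    mP = proj₁ (proj₂ lift)
    eP = proj₁ (proj₂ (proj₂ lift))
    removed = proj₁ (proj₂ (proj₂ (proj₂ lift)))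
    stable = proj₂ (proj₂ (proj₂ (proj₂ lift)))
    pipes≡ : removablePipes w P ≡ js
    pipes≡ = filterᵇ-cong (removable? w P) missing w λ {x} → agree {x}
      where
      agree : x ∈ w → removable? w P x ≡ missing x
      agree {x} x∈ with x ∈? v
      ... | no n = removed (missing⁺ x∈ n)
      ... | yes x∈v =
        trans (stable (subst (x ∈_) (sym words) x∈v))
          (trans (cong (λ u → removable? u R x) words) (All.lookup core x∈v))

theorem3p5 : (n : ℕ) (w : List ℕ) → w ↭ map suc (upTo n) → Avoids1423 w →
    ((P : PipeDream) → IsMRPD w P →
    proj₁ (Φ w P) ⊆ w × IsCMRPD (proj₁ (Φ w P)) (proj₂ (Φ w P)))
    × ((P P′ : PipeDream) → IsMRPD w P → IsMRPD w P′ → Φ w P ≡ Φ w P′ → P ≡ P′)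
    × ((v : List ℕ) (Q : PipeDream) → v ⊆ w → IsCMRPD v Q →
    Σ PipeDream (λ P → IsMRPD w P × Φ w P ≡ (v , Q)))
theorem3p5 n w σ A = Φ-core U , Φ-injective U , Φ-surjective U (avoids A)
  where
  U : Unique w
  U = Unique-resp-↭ (setoid ℕ) (↭⇒↭ₛ (↭-sym σ)) (Unique-map suc-injective (upTo⁺ n))
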